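{- For every positive integer $d$ there is a constant $C_d$ such that every $(d+1)$-uniform hypergraph $\mathcal{H}$ on $n\ge 1$ vertices which is linearly $d$-embeddable satisfies $\chi(\mathcal{H})\leq C_d\, n^{\frac{\lceil d/2\rceil-1}{d}}$.
   Context: A hypergraph is $k$-uniform if all hyperedges have size $k$; its vertex set is assumed to be the union of its hyperedges. For a hypergraph $\mathcal{H}$, $\mathsf{K}(\mathcal{H})$ is the simplicial complex consisting of all subsets of hyperedges of $\mathcal{H}$. $\mathcal{H}$ is linearly $d$-embeddable if there is a map of the vertices into $\mathbb{R}^d$ whose piecewise-linear extension to the geometric realization of $\mathsf{K}(\mathcal{H})$ (each face mapped to the convex hull of the images of its vertices) is an embedding. A (weak) coloring of $\mathcal{H}$ with $m$ colors is a map $c:V(\mathcal{H})\to[m]$ such that no hyperedge is contained in a single color class; $\chi(\mathcal{H})$ is the minimum number of colors. -}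

module Defs where

open import Algebra.Bundles using (CommutativeMonoid)
import Algebra.Properties.AbelianGroup as AbelianGroup-Properties
import Algebra.Properties.CommutativeSemigroup as CommutativeSemigroup-Properties
import Algebra.Properties.Ring as Ring-Properties
open import Data.Fin.Base using (Fin)
open import Data.Fin.Subset using (Subset; _∈_; _∉_; _⊆_; ∣_∣)
open import Data.Integer.Base as ℤ using (+_)
import Data.Integer.Properties as ℤ
open import Data.Nat.Base as ℕ using (ℕ; zero; suc; NonZero)
import Data.Nat.Properties as ℕ
open import Data.Nat.Solver renaming (module +-*-Solver to ℕ-Solver)
open import Data.Product.Base using (∃; _×_; _,_; proj₁; proj₂)
open import Data.Rational.Base as ℚ using (ℚ; mkℚ; 0ℚ; 1ℚ)
import Data.Rational.Properties as ℚ
import Data.Rational.Unnormalised.Base as ℚᵘ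
import Data.Rational.Unnormalised.Properties as ℚᵘ
open import Data.Sum.Base using (inj₁; inj₂)
open import Data.Vec.Functional using (Vector; foldr)
open import Level using (0ℓ)
open import Relation.Binary.PropositionalEquality
  using (_≡_; refl; sym; trans; subst; subst₂; cong; cong₂; module ≡-Reasoning)
open import Relation.Nullary using (¬_; yes; no)
open import Relation.Unary using (Pred; Decidable)

-- Real numbers are Cauchy sequences of rationals; their equality is _≃_, not _≡_.

Cauchy : (ℕ → ℚ) → Set
Cauchy x = ∀ ε → 0ℚ ℚ.< ε →
  ∃ λ N → ∀ m n → N ℕ.≤ m → N ℕ.≤ n → ℚ.∣ x m ℚ.- x n ∣ ℚ.< ε

record ℝ : Set where
  constructor mkℝ
  field
    seq    : ℕ → ℚ
    cauchy : Cauchy seq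

open ℝ public

infix 4 _≃_ _≤ℝ_ _<ℝ_

_<ℝ_ : ℝ → ℝ → Set
x <ℝ y = ∃ λ ε → 0ℚ ℚ.< ε ×
  ∃ λ N → ∀ n → N ℕ.≤ n → seq x n ℚ.+ ε ℚ.≤ seq y n

_≤ℝ_ : ℝ → ℝ → Set
x ≤ℝ y = ∀ ε → 0ℚ ℚ.< ε →
  ∃ λ N → ∀ n → N ℕ.≤ n → seq x n ℚ.≤ seq y n ℚ.+ ε

_≃_ : ℝ → ℝ → Set
x ≃ y = x ≤ℝ y × y ≤ℝ x

private
  module ℚ-Group = AbelianGroup-Properties ℚ.+-0-abelianGroup
  module ℚ-Ring = Ring-Properties ℚ.+-*-ring
  open ℚ-Group using (xyx⁻¹≈y; ⁻¹-anti-homo‿-)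

  telescope : ∀ x y z → (x ℚ.- y) ℚ.+ (y ℚ.- z) ≡ x ℚ.- z
  telescope x y z = begin
      (x ℚ.- y) ℚ.+ (y ℚ.- z)          ≡⟨ ℚ.+-assoc (x ℚ.- y) y (ℚ.- z) ⟨
      (x ℚ.- y) ℚ.+ y ℚ.- z            ≡⟨ cong (ℚ._- z) (ℚ-Group.//-rightDividesˡ y x) ⟩
      x ℚ.- z                          ∎
    where open ≡-Reasoning

  ∣-∣< : ∀ {a b ε} → a ℚ.< b ℚ.+ ε → b ℚ.< a ℚ.+ ε → ℚ.∣ a ℚ.- b ∣ ℚ.< ε
  ∣-∣< {a} {b} {ε} a<b+ε b<a+ε with ℚ.∣p∣≡p∨∣p∣≡-p (a ℚ.- b)
  ... | inj₁ eq = subst₂ ℚ._<_ (sym eq) (xyx⁻¹≈y b ε) (ℚ.+-monoˡ-< (ℚ.- b) a<b+ε)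
  ... | inj₂ eq = subst₂ ℚ._<_
          (sym (trans eq (⁻¹-anti-homo‿- a b))) (xyx⁻¹≈y a ε) (ℚ.+-monoˡ-< (ℚ.- a) b<a+ε)

  *-pos : ∀ {p q} → 0ℚ ℚ.< p → 0ℚ ℚ.< q → 0ℚ ℚ.< p ℚ.* q
  *-pos {p} {q} 0<p 0<q = ℚ.positive⁻¹ (p ℚ.* q)
    {{ℚ.pos*pos⇒pos p {{ℚ.positive 0<p}} q {{ℚ.positive 0<q}}}}

  split : ∀ ε → 0ℚ ℚ.< ε → ∃ λ δ → 0ℚ ℚ.< δ × δ ℚ.+ δ ≡ ε
  split ε 0<ε = ℚ.½ ℚ.* ε , *-pos (ℚ.positive⁻¹ ℚ.½) 0<ε ,
    trans (sym (ℚ.*-distribʳ-+ ε ℚ.½ ℚ.½)) (ℚ.*-identityˡ ε)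

  quotient : ∀ K ε → 0ℚ ℚ.< K → 0ℚ ℚ.< ε → ∃ λ δ → 0ℚ ℚ.< δ × K ℚ.* δ ≡ ε
  quotient K ε 0<K 0<ε = (ℚ.1/ K) ℚ.* ε , *-pos 0<1/K 0<ε , (begin
      K ℚ.* ((ℚ.1/ K) ℚ.* ε)  ≡⟨ ℚ.*-assoc K (ℚ.1/ K) ε ⟨
      K ℚ.* (ℚ.1/ K) ℚ.* ε    ≡⟨ cong (ℚ._* ε) (ℚ.*-inverseʳ K) ⟩
      1ℚ ℚ.* ε                ≡⟨ ℚ.*-identityˡ ε ⟩
      ε                       ∎)
    where
    open ≡-Reasoning
    instance
      K-pos : ℚ.Positive K
      K-pos = ℚ.positive 0<K
      K-nonZero : ℚ.NonZero K
      K-nonZero = ℚ.pos⇒nonZero K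
    0<1/K : 0ℚ ℚ.< ℚ.1/ K
    0<1/K = ℚ.positive⁻¹ (ℚ.1/ K) {{ℚ.1/pos⇒pos K}}

  bounded : (x : ℝ) →
    ∃ λ K → 0ℚ ℚ.< K × ∃ λ N → ∀ n → N ℕ.≤ n → ℚ.∣ seq x n ∣ ℚ.≤ K
  bounded (mkℝ x c) with c 1ℚ (ℚ.positive⁻¹ 1ℚ)
  ... | N , close = 1ℚ ℚ.+ ℚ.∣ x N ∣ ,
        ℚ.<-≤-trans (ℚ.positive⁻¹ 1ℚ)
          (subst (ℚ._≤ 1ℚ ℚ.+ ℚ.∣ x N ∣) (ℚ.+-identityʳ 1ℚ)
            (ℚ.+-monoʳ-≤ 1ℚ (ℚ.0≤∣p∣ (x N)))) ,
        N , λ n N≤n → begin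
          ℚ.∣ x n ∣
            ≡⟨ cong ℚ.∣_∣ (ℚ-Group.//-rightDividesˡ (x N) (x n)) ⟨
          ℚ.∣ x n ℚ.- x N ℚ.+ x N ∣
            ≤⟨ ℚ.∣p+q∣≤∣p∣+∣q∣ (x n ℚ.- x N) (x N) ⟩
          ℚ.∣ x n ℚ.- x N ∣ ℚ.+ ℚ.∣ x N ∣
            ≤⟨ ℚ.+-monoˡ-≤ ℚ.∣ x N ∣ (ℚ.<⇒≤ (close n N N≤n ℕ.≤-refl)) ⟩
          1ℚ ℚ.+ ℚ.∣ x N ∣ ∎
    where open ℚ.≤-Reasoning

  const-cauchy : ∀ q → Cauchy (λ _ → q)
  const-cauchy q ε 0<ε = 0 , λ _ _ _ _ →
    subst (λ r → ℚ.∣ r ∣ ℚ.< ε) (sym (ℚ.+-inverseʳ q)) 0<ε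

  +-difference : ∀ a b c d →
    (a ℚ.+ b) ℚ.- (c ℚ.+ d) ≡ (a ℚ.- c) ℚ.+ (b ℚ.- d)
  +-difference a b c d = trans
    (cong (a ℚ.+ b ℚ.+_) (ℚ.neg-distrib-+ c d))
    (interchange a b (ℚ.- c) (ℚ.- d))
    where open CommutativeSemigroup-Properties
            (CommutativeMonoid.commutativeSemigroup ℚ.+-0-commutativeMonoid)

  +-cauchy : (x y : ℝ) → Cauchy (λ n → seq x n ℚ.+ seq y n)
  +-cauchy (mkℝ x cx) (mkℝ y cy) ε 0<ε with split ε 0<ε
  ... | δ , 0<δ , δ+δ≡ε with cx δ 0<δ | cy δ 0<δ
  ... | M , closeˣ | N , closeʸ = M ℕ.⊔ N , λ m n ≤m ≤n → begin-strict
      ℚ.∣ (x m ℚ.+ y m) ℚ.- (x n ℚ.+ y n) ∣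
        ≡⟨ cong ℚ.∣_∣ (+-difference (x m) (y m) (x n) (y n)) ⟩
      ℚ.∣ (x m ℚ.- x n) ℚ.+ (y m ℚ.- y n) ∣
        ≤⟨ ℚ.∣p+q∣≤∣p∣+∣q∣ (x m ℚ.- x n) (y m ℚ.- y n) ⟩
      ℚ.∣ x m ℚ.- x n ∣ ℚ.+ ℚ.∣ y m ℚ.- y n ∣
        <⟨ ℚ.+-mono-< (closeˣ m n (ℕ.m⊔n≤o⇒m≤o M N ≤m) (ℕ.m⊔n≤o⇒m≤o M N ≤n))
                      (closeʸ m n (ℕ.m⊔n≤o⇒n≤o M N ≤m) (ℕ.m⊔n≤o⇒n≤o M N ≤n)) ⟩
      δ ℚ.+ δ
        ≡⟨ δ+δ≡ε ⟩
      ε ∎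
    where open ℚ.≤-Reasoning

  *-bound : ∀ {K δ} a b → 0ℚ ℚ.< K → ℚ.∣ a ∣ ℚ.≤ K → ℚ.∣ b ∣ ℚ.< δ →
    ℚ.∣ a ℚ.* b ∣ ℚ.< K ℚ.* δ
  *-bound {K} {δ} a b 0<K a≤K b<δ = begin-strict
      ℚ.∣ a ℚ.* b ∣          ≡⟨ ℚ.∣p*q∣≡∣p∣*∣q∣ a b ⟩
      ℚ.∣ a ∣ ℚ.* ℚ.∣ b ∣    ≤⟨ ℚ.*-monoʳ-≤-nonNeg ℚ.∣ b ∣ {{ℚ.∣-∣-nonNeg b}} a≤K ⟩
      K ℚ.* ℚ.∣ b ∣          <⟨ ℚ.*-monoʳ-<-pos K {{ℚ.positive 0<K}} b<δ ⟩
      K ℚ.* δ                ∎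
    where open ℚ.≤-Reasoning

  *-difference : ∀ a b c d →
    a ℚ.* b ℚ.- c ℚ.* d ≡ a ℚ.* (b ℚ.- d) ℚ.+ d ℚ.* (a ℚ.- c)
  *-difference a b c d = begin
      a ℚ.* b ℚ.- c ℚ.* d
        ≡⟨ telescope (a ℚ.* b) (a ℚ.* d) (c ℚ.* d) ⟨
      (a ℚ.* b ℚ.- a ℚ.* d) ℚ.+ (a ℚ.* d ℚ.- c ℚ.* d)
        ≡⟨ cong₂ ℚ._+_ (ℚ-Ring.x[y-z]≈xy-xz a b d) (ℚ-Ring.[y-z]x≈yx-zx d a c) ⟨
      a ℚ.* (b ℚ.- d) ℚ.+ (a ℚ.- c) ℚ.* d
        ≡⟨ cong (a ℚ.* (b ℚ.- d) ℚ.+_) (ℚ.*-comm (a ℚ.- c) d) ⟩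
      a ℚ.* (b ℚ.- d) ℚ.+ d ℚ.* (a ℚ.- c) ∎
    where open ≡-Reasoning

  *-close : ∀ {K L δ θ η ε} a b c d →
    0ℚ ℚ.< K → 0ℚ ℚ.< L → K ℚ.* δ ≡ η → L ℚ.* θ ≡ η → η ℚ.+ η ≡ ε →
    ℚ.∣ a ∣ ℚ.≤ K → ℚ.∣ d ∣ ℚ.≤ L → ℚ.∣ b ℚ.- d ∣ ℚ.< δ → ℚ.∣ a ℚ.- c ∣ ℚ.< θ →
    ℚ.∣ a ℚ.* b ℚ.- c ℚ.* d ∣ ℚ.< ε
  *-close {K} {L} {δ} {θ} {η} {ε} a b c d 0<K 0<L Kδ≡η Lθ≡η η+η≡ε a≤K d≤L db da =
    begin-strict
      ℚ.∣ a ℚ.* b ℚ.- c ℚ.* d ∣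
        ≡⟨ cong ℚ.∣_∣ (*-difference a b c d) ⟩
      ℚ.∣ a ℚ.* (b ℚ.- d) ℚ.+ d ℚ.* (a ℚ.- c) ∣
        ≤⟨ ℚ.∣p+q∣≤∣p∣+∣q∣ (a ℚ.* (b ℚ.- d)) (d ℚ.* (a ℚ.- c)) ⟩
      ℚ.∣ a ℚ.* (b ℚ.- d) ∣ ℚ.+ ℚ.∣ d ℚ.* (a ℚ.- c) ∣
        <⟨ ℚ.+-mono-< (*-bound a (b ℚ.- d) 0<K a≤K db) (*-bound d (a ℚ.- c) 0<L d≤L da) ⟩
      K ℚ.* δ ℚ.+ L ℚ.* θ
        ≡⟨ cong₂ ℚ._+_ Kδ≡η Lθ≡η ⟩
      η ℚ.+ η
        ≡⟨ η+η≡ε ⟩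
      ε ∎
    where open ℚ.≤-Reasoning

  *-cauchy : (x y : ℝ) → Cauchy (λ n → seq x n ℚ.* seq y n)
  *-cauchy (mkℝ x cx) (mkℝ y cy) ε 0<ε with split ε 0<ε | bounded (mkℝ x cx) | bounded (mkℝ y cy)
  ... | η , 0<η , η+η≡ε | K , 0<K , A , x≤K | L , 0<L , B , y≤L
    with quotient K η 0<K 0<η | quotient L η 0<L 0<η
  ... | δ , 0<δ , Kδ≡η | θ , 0<θ , Lθ≡η with cy δ 0<δ | cx θ 0<θ
  ... | N , closeʸ | M , closeˣ = (A ℕ.⊔ B) ℕ.⊔ (M ℕ.⊔ N) , λ m n ≤m ≤n →
    let ≤mˡ = ℕ.m⊔n≤o⇒m≤o (A ℕ.⊔ B) (M ℕ.⊔ N) ≤m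
        ≤mʳ = ℕ.m⊔n≤o⇒n≤o (A ℕ.⊔ B) (M ℕ.⊔ N) ≤m
        ≤nˡ = ℕ.m⊔n≤o⇒m≤o (A ℕ.⊔ B) (M ℕ.⊔ N) ≤n
        ≤nʳ = ℕ.m⊔n≤o⇒n≤o (A ℕ.⊔ B) (M ℕ.⊔ N) ≤n
    in *-close (x m) (y m) (x n) (y n) 0<K 0<L Kδ≡η Lθ≡η η+η≡ε
         (x≤K m (ℕ.m⊔n≤o⇒m≤o A B ≤mˡ)) (y≤L n (ℕ.m⊔n≤o⇒n≤o A B ≤nˡ))
         (closeʸ m n (ℕ.m⊔n≤o⇒n≤o M N ≤mʳ) (ℕ.m⊔n≤o⇒n≤o M N ≤nʳ))
         (closeˣ m n (ℕ.m⊔n≤o⇒m≤o M N ≤mʳ) (ℕ.m⊔n≤o⇒m≤o M N ≤nʳ))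

infixl 6 _+ℝ_
infixl 7 _*ℝ_

fromℚ : ℚ → ℝ
fromℚ q = mkℝ (λ _ → q) (const-cauchy q)

fromℕ : ℕ → ℝ
fromℕ n = fromℚ (+ n ℚ./ 1)

0ℝ 1ℝ : ℝ
0ℝ = fromℚ 0ℚ
1ℝ = fromℚ 1ℚ

_+ℝ_ : ℝ → ℝ → ℝ
x +ℝ y = mkℝ (λ n → seq x n ℚ.+ seq y n) (+-cauchy x y)

_*ℝ_ : ℝ → ℝ → ℝ
x *ℝ y = mkℝ (λ n → seq x n ℚ.* seq y n) (*-cauchy x y)

∑ : ∀ {n} → Vector ℝ n → ℝ
∑ = foldr _+ℝ_ 0ℝ

searchRoot : (q M bound : ℕ) → ℕ
searchRoot q M zero    = 0
searchRoot q M (suc b) with suc b ℕ.^ q ℕ.≤? M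
... | yes _ = suc b
... | no  _ = searchRoot q M b

-- For q ≥ 1 this is the largest m with m ^ q ≤ M.
⌊root⌋ : (q M : ℕ) → ℕ
⌊root⌋ q M = searchRoot q M M

private
  searchRoot-lower : ∀ q M b .{{_ : NonZero q}} → searchRoot q M b ℕ.^ q ℕ.≤ M
  searchRoot-lower (suc q) M zero = ℕ.z≤n
  searchRoot-lower q M (suc b) with suc b ℕ.^ q ℕ.≤? M
  ... | yes p = p
  ... | no  _ = searchRoot-lower q M b

  searchRoot-upper : ∀ q M b → M ℕ.< suc b ℕ.^ q → M ℕ.< suc (searchRoot q M b) ℕ.^ q
  searchRoot-upper q M zero    h = h
  searchRoot-upper q M (suc b) h with suc b ℕ.^ q ℕ.≤? M
  ... | yes _ = h
  ... | no ¬p = searchRoot-upper q M b (ℕ.≰⇒> ¬p)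

  n≤n^q : ∀ n q .{{_ : NonZero n}} .{{_ : NonZero q}} → n ℕ.≤ n ℕ.^ q
  n≤n^q n (suc q) = ℕ.m≤m*n n (n ℕ.^ q) {{ℕ.m^n≢0 n q}}

⌊root⌋-lower : ∀ q M .{{_ : NonZero q}} → ⌊root⌋ q M ℕ.^ q ℕ.≤ M
⌊root⌋-lower q M = searchRoot-lower q M M

⌊root⌋-upper : ∀ q M .{{_ : NonZero q}} → M ℕ.< suc (⌊root⌋ q M) ℕ.^ q
⌊root⌋-upper q M = searchRoot-upper q M M (n≤n^q (suc M) q)

private
  ^-cancel-< : ∀ q {a b} → a ℕ.^ q ℕ.< b ℕ.^ q → a ℕ.< b
  ^-cancel-< q {a} {b} h with a ℕ.<? b
  ... | yes a<b = a<b
  ... | no  a≮b with () ← ℕ.<-irrefl refl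
        (ℕ.<-≤-trans h (ℕ.^-monoˡ-≤ q (ℕ.≮⇒≥ a≮b)))

  ^-distrib-* : ∀ a b q → (a ℕ.* b) ℕ.^ q ≡ a ℕ.^ q ℕ.* b ℕ.^ q
  ^-distrib-* a b zero    = refl
  ^-distrib-* a b (suc q) rewrite ^-distrib-* a b q =
    solve 4 (λ a b c d → a :* b :* (c :* d) := a :* c :* (b :* d)) refl
      a b (a ℕ.^ q) (b ℕ.^ q)
    where open ℕ-Solver

  cross : ∀ q N k l .{{_ : NonZero q}} →
    ⌊root⌋ q (N ℕ.* suc k ℕ.^ q) ℕ.* suc l
      ℕ.< suc (⌊root⌋ q (N ℕ.* suc l ℕ.^ q)) ℕ.* suc k
  cross q N k l = ^-cancel-< q (begin-strict
      (r ℕ.* suc l) ℕ.^ q                   ≡⟨ ^-distrib-* r (suc l) q ⟩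
      r ℕ.^ q ℕ.* L                         ≤⟨ ℕ.*-monoˡ-≤ L (⌊root⌋-lower q (N ℕ.* K)) ⟩
      N ℕ.* K ℕ.* L                         ≡⟨ solve 3 (λ n a b → n :* a :* b := n :* b :* a) refl N K L ⟩
      N ℕ.* L ℕ.* K                         <⟨ ℕ.*-monoˡ-< K {{ℕ.m^n≢0 (suc k) q}} (⌊root⌋-upper q (N ℕ.* L)) ⟩
      suc s ℕ.^ q ℕ.* K                     ≡⟨ ^-distrib-* (suc s) (suc k) q ⟨
      (suc s ℕ.* suc k) ℕ.^ q               ∎)
    where
    open ℕ.≤-Reasoning
    open ℕ-Solver
    K = suc k ℕ.^ q
    L = suc l ℕ.^ q
    r = ⌊root⌋ q (N ℕ.* K)
    s = ⌊root⌋ q (N ℕ.* L)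

  frac-< : ∀ a b k l → a ℕ.* suc l ℕ.< b ℕ.* suc k → + a ℚ./ suc k ℚ.< + b ℚ./ suc l
  frac-< a b k l h = ℚ.toℚᵘ-cancel-< (ℚᵘ.<-respʳ-≃
      (ℚᵘ.≃-sym (ℚ.toℚᵘ-fromℚᵘ (ℚᵘ.mkℚᵘ (+ b) l)))
      (ℚᵘ.<-respˡ-≃
        (ℚᵘ.≃-sym (ℚ.toℚᵘ-fromℚᵘ (ℚᵘ.mkℚᵘ (+ a) k)))
        (ℚᵘ.*<* (subst₂ ℤ._<_ (ℤ.pos-* a (suc l)) (ℤ.pos-* b (suc k)) (ℤ.+<+ h)))))

  unit-suc : ∀ b l → ℚᵘ.mkℚᵘ (+ suc b) l ℚᵘ.≃ ℚᵘ.mkℚᵘ (+ b) l ℚᵘ.+ ℚᵘ.mkℚᵘ (+ 1) l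
  unit-suc b l = ℚᵘ.*≡* (begin
      + suc b ℤ.* + (suc l ℕ.* suc l)
        ≡⟨ cong (+ suc b ℤ.*_) (ℤ.pos-* (suc l) (suc l)) ⟩
      + suc b ℤ.* (L ℤ.* L)
        ≡⟨ ℤ.*-assoc (+ suc b) L L ⟨
      (+ 1 ℤ.+ + b) ℤ.* L ℤ.* L
        ≡⟨ cong (λ z → z ℤ.* L ℤ.* L) (ℤ.+-comm (+ 1) (+ b)) ⟩
      (+ b ℤ.+ + 1) ℤ.* L ℤ.* L
        ≡⟨ cong (ℤ._* L) (ℤ.*-distribʳ-+ L (+ b) (+ 1)) ⟩
      (+ b ℤ.* L ℤ.+ + 1 ℤ.* L) ℤ.* L ∎)
    where
    open ≡-Reasoning
    L = + suc l

  frac-suc : ∀ b l → + suc b ℚ./ suc l ≡ + b ℚ./ suc l ℚ.+ + 1 ℚ./ suc l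
  frac-suc b l = ℚ.toℚᵘ-injective (begin-equality
      ℚ.toℚᵘ (+ suc b ℚ./ suc l)
        ≃⟨ ℚ.toℚᵘ-fromℚᵘ (ℚᵘ.mkℚᵘ (+ suc b) l) ⟩
      ℚᵘ.mkℚᵘ (+ suc b) l
        ≃⟨ unit-suc b l ⟩
      ℚᵘ.mkℚᵘ (+ b) l ℚᵘ.+ ℚᵘ.mkℚᵘ (+ 1) l
        ≃⟨ ℚᵘ.+-cong (ℚ.toℚᵘ-fromℚᵘ (ℚᵘ.mkℚᵘ (+ b) l)) (ℚ.toℚᵘ-fromℚᵘ (ℚᵘ.mkℚᵘ (+ 1) l)) ⟨
      ℚ.toℚᵘ (+ b ℚ./ suc l) ℚᵘ.+ ℚ.toℚᵘ (+ 1 ℚ./ suc l)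
        ≃⟨ ℚ.toℚᵘ-homo-+ (+ b ℚ./ suc l) (+ 1 ℚ./ suc l) ⟨
      ℚ.toℚᵘ (+ b ℚ./ suc l ℚ.+ + 1 ℚ./ suc l) ∎)
    where open ℚᵘ.≤-Reasoning

  small : ∀ ε → 0ℚ ℚ.< ε → ∃ λ N → ∀ l → N ℕ.≤ l → + 1 ℚ./ suc l ℚ.< ε
  small ε 0<ε with ℚ.positive 0<ε
  small ε@(mkℚ ℤ.+[1+ a ] b c) 0<ε | _ = suc b , λ l b<l →
    subst (+ 1 ℚ./ suc l ℚ.<_) (ℚ.fromℚᵘ-toℚᵘ ε)
      (frac-< 1 (suc a) l b (begin-strict
        1 ℕ.* suc b      ≡⟨ ℕ.*-identityˡ (suc b) ⟩
        suc b            <⟨ ℕ.s≤s b<l ⟩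
        suc l            ≤⟨ ℕ.m≤n*m (suc l) (suc a) ⟩
        suc a ℕ.* suc l  ∎))
    where open ℕ.≤-Reasoning

rootSeq : (q N : ℕ) → ℕ → ℚ
rootSeq q N k = + ⌊root⌋ q (N ℕ.* suc k ℕ.^ q) ℚ./ suc k

private
  rootSeq-step : ∀ q N k l .{{_ : NonZero q}} →
    rootSeq q N k ℚ.< rootSeq q N l ℚ.+ + 1 ℚ./ suc l
  rootSeq-step q N k l = subst (rootSeq q N k ℚ.<_) (frac-suc s l)
    (frac-< (⌊root⌋ q (N ℕ.* suc k ℕ.^ q)) (suc s) k l (cross q N k l))
    where s = ⌊root⌋ q (N ℕ.* suc l ℕ.^ q)

  rootSeq-cauchy : ∀ q N .{{_ : NonZero q}} → Cauchy (rootSeq q N)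
  rootSeq-cauchy q N ε 0<ε with small ε 0<ε
  ... | B , 1/l<ε = B , λ m n B≤m B≤n → ∣-∣<
    (ℚ.<-trans (rootSeq-step q N m n) (ℚ.+-monoʳ-< (rootSeq q N n) (1/l<ε n B≤n)))
    (ℚ.<-trans (rootSeq-step q N n m) (ℚ.+-monoʳ-< (rootSeq q N m) (1/l<ε m B≤m)))

-- The real q-th root of N, as the limit of ⌊(k+1) N^(1/q)⌋ / (k+1).
root : (q : ℕ) .{{_ : NonZero q}} → ℕ → ℝ
root q N = mkℝ (rootSeq q N) (rootSeq-cauchy q N)

infixr 8 _^[_/_]

-- n^(a/q) is the q-th root of n^a.
_^[_/_] : ℕ → ℕ → (q : ℕ) .{{_ : NonZero q}} → ℝ
n ^[ a / q ] = root q (n ℕ.^ a)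

_≈_ : ∀ {m} → Vector ℝ m → Vector ℝ m → Set
x ≈ y = ∀ i → x i ≃ y i

-- |xᵢ - yᵢ| < ε for every coordinate i, i.e. distance below ε in the
-- maximum metric, which induces the usual topology.
Close : ∀ {m} → ℝ → Vector ℝ m → Vector ℝ m → Set
Close ε x y = ∀ i → (x i <ℝ y i +ℝ ε) × (y i <ℝ x i +ℝ ε)

-- f restricted to X is a homeomorphism onto its image.
record IsEmbedding {m d} (X : Pred (Vector ℝ m) 0ℓ)
                   (f : Vector ℝ m → Vector ℝ d) : Set where
  field
    injective : ∀ {x y} → X x → X y → f x ≈ f y → x ≈ y
    continuous : ∀ {x} → X x → ∀ ε → 0ℝ <ℝ ε → ∃ λ δ → 0ℝ <ℝ δ ×
      (∀ {y} → X y → Close δ x y → Close ε (f x) (f y))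
    inverse-continuous : ∀ {x} → X x → ∀ ε → 0ℝ <ℝ ε → ∃ λ δ → 0ℝ <ℝ δ ×
      (∀ {y} → X y → Close δ (f x) (f y) → Close ε x y)

record Hypergraph (n : ℕ) : Set₁ where
  field
    Edge    : Pred (Subset n) 0ℓ
    edge?   : Decidable Edge
    covered : ∀ v → ∃ λ e → Edge e × v ∈ e

module _ {n : ℕ} (H : Hypergraph n) where
  open Hypergraph H

  Uniform : ℕ → Set
  Uniform k = ∀ e → Edge e → ∣ e ∣ ≡ k

  -- The simplices of K(H), including the empty one.
  Face : Pred (Subset n) 0ℓ
  Face s = ∃ λ e → Edge e × s ⊆ e

  -- The geometric realization of K(H) as a subspace of ℝⁿ: α is a point
  -- given by its barycentric coordinates, vanishing outside some simplex.
  record Realization (α : Vector ℝ n) : Set where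
    field
      nonNegative : ∀ v → 0ℝ ≤ℝ α v
      total       : ∑ α ≃ 1ℝ
      support     : ∃ λ s → Face s × (∀ v → v ∉ s → α v ≃ 0ℝ)

  Coloring : ℕ → Set
  Coloring m = ∃ λ (c : Fin n → Fin m) →
    ∀ e → Edge e → ∀ i → ¬ (∀ v → v ∈ e → c v ≡ i)

  IsChromaticNumber : ℕ → Set
  IsChromaticNumber χ = Coloring χ × (∀ m → Coloring m → χ ℕ.≤ m)

-- The linear extension of vertex images p to barycentric coordinates: it
-- maps each simplex s affinely onto the convex hull of { p v | v ∈ s }.
plExtension : ∀ {n d} → (Fin n → Vector ℝ d) → Vector ℝ n → Vector ℝ d
plExtension p α i = ∑ (λ v → α v *ℝ p v i)

LinearlyEmbeddable : ∀ {n} → ℕ → Hypergraph n → Set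
LinearlyEmbeddable {n} d H = ∃ λ (p : Fin n → Vector ℝ d) →
  IsEmbedding (Realization H) (plExtension p)

{-# OPTIONS --safe #-}
-- Let k = ⌈ d /2⌉ and let p be a linear embedding in ℝᵈ. The vertices of an edge e are affinely independent, so
-- for a generic vector u we have u = ∑ aᵥ pᵥ with v ranging over e, ∑ aᵥ = 0 and all aᵥ nonzero. Of the sets
-- {v | aᵥ < 0} and {v | aᵥ > 0} one, say τ, has at most k elements; up to sign, starting from the barycenter of τ
-- and moving along u one enters the interior of e. As the simplices of an embedding meet only in common faces, τ
-- and the sign determine e. Hence every set W of vertices contains at most 2 ∣W∣ᵏ edges.
-- If k ≥ 2, colour W with q ≈ ∣W∣^((k-1)/d) colours so that at most 2 ∣W∣ᵏ / qᵈ edges are monochromatic, pick a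
-- vertex from each of these, and colour the picked vertices recursively with fresh colours; the numbers of
-- colours form a geometric series. If k = 1, there is always a vertex of degree at most 2 (d + 1), and the
-- greedy colouring works.
-- The order of the reals is undecidable, but the bound on the number of edges is decidable, so the geometric
-- part may be carried out under a double negation.

module Submission where

open import Defs hiding (_≈_)
open import Algebra.Bundles using (CommutativeSemiring)
import Algebra.Properties.Semiring.Sum as Semiring-Sum
import Algebra.Solver.Ring.NaturalCoefficients.Default as NaturalCoefficients
open import Data.Bool.Base using (Bool; true; false; not; if_then_else_)
open import Data.Fin.Base using (Fin; zero; suc; _↑ˡ_; _↑ʳ_; splitAt; inject≤)
open import Data.Fin.Properties using (any?; all?; inject≤-injective; splitAt-↑ˡ; splitAt-↑ʳ)
  renaming (_≟_ to _≟ꟳ_)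
open import Data.Fin.Subset
  using (Subset; inside; outside; _∈_; _∉_; _⊆_; ∣_∣; Nonempty; _∩_; _∪_; ∁; ⁅_⁆; _-_; ⊤; ⊥)
open import Data.Fin.Subset.Properties
import Data.Integer.Base as ℤ
import Data.Integer.Properties as ℤ
open import Data.List.Base
  using (List; []; _∷_; _++_; map; cartesianProduct; cartesianProductWith; allFin; filter; length)
import Data.List.Properties as List
open import Data.List.Membership.Propositional using () renaming (_∈_ to _∈ˡ_; _∉_ to _∉ˡ_)
import Data.List.Membership.DecPropositional as DecMembership
open import Data.List.Membership.Propositional.Properties
  using (∈-map⁺; ∈-map⁻; ∈-++⁺ˡ; ∈-++⁺ʳ; ∈-++⁻; ∈-∃++; ∈-filter⁺; ∈-filter⁻;
         ∈-cartesianProduct⁺; ∈-cartesianProductWith⁺; ∈-allFin)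
open import Data.List.Relation.Unary.All as All using (All; []; _∷_)
open import Data.List.Relation.Unary.AllPairs using ([]; _∷_)
open import Data.List.Relation.Unary.Any using (here; there)
open import Data.List.Relation.Unary.Unique.Propositional using (Unique)
import Data.List.Relation.Unary.Unique.Propositional.Properties as Unique
open import Data.Nat.Base as ℕ using (ℕ; zero; suc; NonZero; _∸_; ⌈_/2⌉; ⌊_/2⌋)
import Data.Nat.Properties as ℕ
open import Data.Nat.Solver renaming (module +-*-Solver to ℕ-Solver)
open import Data.Product.Base using (∃; _×_; _,_; proj₁; proj₂)
open import Data.Rational.Base as ℚ using (ℚ; 0ℚ; 1ℚ)
import Data.Rational.Properties as ℚ
open import Data.Rational.Solver renaming (module +-*-Solver to ℚ-Solver)
import Data.Rational.Unnormalised.Base as ℚᵘ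
import Data.Rational.Unnormalised.Properties as ℚᵘ
open import Data.Sum.Base using (_⊎_; inj₁; inj₂; [_,_]′; swap)
open import Data.Vec.Base using (Vec; []; _∷_; here; there; lookup; tabulate)
open import Data.Vec.Properties using ([]=⇒lookup; lookup⇒[]=; lookup∘tabulate)
open import Function.Base using (_∘_; id)
open import Level using (0ℓ)
open import Relation.Binary.PropositionalEquality as ≡ using (_≡_; _≢_; module ≡-Reasoning)
open import Relation.Nullary using (¬_; Dec; yes; no; does; contradiction; ¬?; _×-dec_; _→-dec_)
open import Relation.Nullary.Decidable using (¬¬-excluded-middle; decidable-stable; map′)
open import Relation.Unary using (Decidable)

-- Cauchy reals

-- Genericity of u comes from lines u + s w: such a line meets the span of a facet at most once,
-- unless u and w both lie in it. So if each of finitely many spans is avoided by u or by w, all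
-- large s avoid all of them. Points get an additional coordinate 1, which turns affine dependences
-- into linear ones; directions have first coordinate 0. A Cauchy real that is merely nonzero comes
-- with no lower bound by which to invert it, so relations are kept in the form ∑ aᵥ pᵥ = κ u with κ
-- nonzero. In the colouring, roots of ∣W∣ are rarely integers. Sizes are therefore rounded up to
-- powers 2 ^ (d j), whose d-th roots are exact, and the constants pay for the rounding. For k = 1
-- this recursion would spend the same number of colours at each of logarithmically many scales,
-- which is why that case has an argument of its own.

^-distribʳ-* : ∀ q a b → (a ℕ.* b) ℕ.^ q ≡ a ℕ.^ q ℕ.* b ℕ.^ q
^-distribʳ-* zero    a b = ≡.refl
^-distribʳ-* (suc q) a b rewrite ^-distribʳ-* q a b =
  solve 4 (λ a b c d → a :* b :* (c :* d) := a :* c :* (b :* d)) ≡.refl a b (a ℕ.^ q) (b ℕ.^ q)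
  where open ℕ-Solver

module Real where

  open import Data.Integer.Base using (+_)
  open ≡ using (refl; sym; trans; cong; cong₂; subst; subst₂)

  Eventually : (ℕ → Set) → Set
  Eventually P = ∃ λ N → ∀ n → N ℕ.≤ n → P n

  always : ∀ {P : ℕ → Set} → (∀ n → P n) → Eventually P
  always p = 0 , λ n _ → p n

  zipEventually : ∀ {P Q R : ℕ → Set} → (∀ n → P n → Q n → R n) →
    Eventually P → Eventually Q → Eventually R
  zipEventually f (M , p) (N , q) = M ℕ.⊔ N , λ n ≤n →
    f n (p n (ℕ.m⊔n≤o⇒m≤o M N ≤n)) (q n (ℕ.m⊔n≤o⇒n≤o M N ≤n))

  mapEventually : ∀ {P R : ℕ → Set} → (∀ n → P n → R n) → Eventually P → Eventually R
  mapEventually f (N , p) = N , λ n ≤n → f n (p n ≤n)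

  *-pos : ∀ {p q} → 0ℚ ℚ.< p → 0ℚ ℚ.< q → 0ℚ ℚ.< p ℚ.* q
  *-pos {p} {q} 0<p 0<q = ℚ.positive⁻¹ (p ℚ.* q)
    {{ℚ.pos*pos⇒pos p {{ℚ.positive 0<p}} q {{ℚ.positive 0<q}}}}

  half : ∀ ε → 0ℚ ℚ.< ε → ∃ λ δ → 0ℚ ℚ.< δ × δ ℚ.+ δ ≡ ε
  half ε 0<ε = ℚ.½ ℚ.* ε , *-pos (ℚ.positive⁻¹ ℚ.½) 0<ε ,
    trans (sym (ℚ.*-distribʳ-+ ε ℚ.½ ℚ.½)) (ℚ.*-identityˡ ε)

  quotient : ∀ K ε → 0ℚ ℚ.< K → 0ℚ ℚ.< ε → ∃ λ δ → 0ℚ ℚ.< δ × K ℚ.* δ ≡ ε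
  quotient K ε 0<K 0<ε = (ℚ.1/ K) ℚ.* ε , *-pos (ℚ.positive⁻¹ (ℚ.1/ K) {{ℚ.1/pos⇒pos K}}) 0<ε ,
    trans (sym (ℚ.*-assoc K (ℚ.1/ K) ε))
      (trans (cong (ℚ._* ε) (ℚ.*-inverseʳ K)) (ℚ.*-identityˡ ε))
    where
    instance
      K-pos : ℚ.Positive K
      K-pos = ℚ.positive 0<K
      K-nonZero : ℚ.NonZero K
      K-nonZero = ℚ.pos⇒nonZero K

  p≤∣p∣ : ∀ p → p ℚ.≤ ℚ.∣ p ∣
  p≤∣p∣ p with ℚ.≤-total 0ℚ p
  ... | inj₁ 0≤p = ℚ.≤-reflexive (sym (ℚ.0≤p⇒∣p∣≡p 0≤p))
  ... | inj₂ p≤0 = ℚ.≤-trans p≤0 (ℚ.0≤∣p∣ p)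

  -p≤∣p∣ : ∀ p → ℚ.- p ℚ.≤ ℚ.∣ p ∣
  -p≤∣p∣ p = subst (ℚ.- p ℚ.≤_) (ℚ.∣-p∣≡∣p∣ p) (p≤∣p∣ (ℚ.- p))

  ∣∣≤ : ∀ {p q} → p ℚ.≤ q → ℚ.- p ℚ.≤ q → ℚ.∣ p ∣ ℚ.≤ q
  ∣∣≤ {p} ≤q -≤q with ℚ.∣p∣≡p∨∣p∣≡-p p
  ... | inj₁ eq = subst (ℚ._≤ _) (sym eq) ≤q
  ... | inj₂ eq = subst (ℚ._≤ _) (sym eq) -≤q

  x-y≤ε⇒x≤y+ε : ∀ x y ε → x ℚ.- y ℚ.≤ ε → x ℚ.≤ y ℚ.+ ε
  x-y≤ε⇒x≤y+ε x y ε h = subst (ℚ._≤ y ℚ.+ ε)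
    (solve 2 (λ x y → y :+ (x :- y) := x) refl x y) (ℚ.+-monoʳ-≤ y h)
    where open ℚ-Solver

  x≤y+ε⇒x-y≤ε : ∀ x y ε → x ℚ.≤ y ℚ.+ ε → x ℚ.- y ℚ.≤ ε
  x≤y+ε⇒x-y≤ε x y ε h = subst (x ℚ.- y ℚ.≤_)
    (solve 2 (λ y e → y :+ e :- y := e) refl y ε) (ℚ.+-monoˡ-≤ (ℚ.- y) h)
    where open ℚ-Solver

  -- Describing equality by a difference tending to 0 reduces the congruence laws to ring identities
  -- over the rationals.
  Null : (ℕ → ℚ) → Set
  Null s = ∀ ε → 0ℚ ℚ.< ε → Eventually λ n → ℚ.∣ s n ∣ ℚ.≤ ε

  ≃⇒null : ∀ x y → x ≃ y → Null (λ n → seq x n ℚ.- seq y n)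
  ≃⇒null x y (x≤y , y≤x) ε 0<ε = zipEventually
    (λ n p q → ∣∣≤ (x≤y+ε⇒x-y≤ε (seq x n) (seq y n) ε p)
      (subst (ℚ._≤ ε) (solve 2 (λ x y → y :- x := :- (x :- y)) refl (seq x n) (seq y n))
        (x≤y+ε⇒x-y≤ε (seq y n) (seq x n) ε q)))
    (x≤y ε 0<ε) (y≤x ε 0<ε)
    where open ℚ-Solver

  null⇒≃ : ∀ x y → Null (λ n → seq x n ℚ.- seq y n) → x ≃ y
  null⇒≃ x y null =
    (λ ε 0<ε → mapEventually (λ n h → x-y≤ε⇒x≤y+ε (seq x n) (seq y n) ε
      (ℚ.≤-trans (p≤∣p∣ (seq x n ℚ.- seq y n)) h)) (null ε 0<ε)) ,
    (λ ε 0<ε → mapEventually (λ n h → x-y≤ε⇒x≤y+ε (seq y n) (seq x n) ε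
      (subst (ℚ._≤ ε) (solve 2 (λ x y → :- (x :- y) := y :- x) refl (seq x n) (seq y n))
        (ℚ.≤-trans (-p≤∣p∣ (seq x n ℚ.- seq y n)) h))) (null ε 0<ε))
    where open ℚ-Solver

  null-resp : ∀ {s t : ℕ → ℚ} → (∀ n → s n ≡ t n) → Null s → Null t
  null-resp eq null ε 0<ε = mapEventually (λ n → subst (λ q → ℚ.∣ q ∣ ℚ.≤ ε) (eq n)) (null ε 0<ε)

  null-+ : ∀ {s t : ℕ → ℚ} → Null s → Null t → Null (λ n → s n ℚ.+ t n)
  null-+ {s} {t} null-s null-t ε 0<ε with half ε 0<ε
  ... | δ , 0<δ , refl = zipEventually
    (λ n p q → ℚ.≤-trans (ℚ.∣p+q∣≤∣p∣+∣q∣ (s n) (t n)) (ℚ.+-mono-≤ p q))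
    (null-s δ 0<δ) (null-t δ 0<δ)

  ∣*∣≤ : ∀ {K δ} a b → 0ℚ ℚ.< K → ℚ.∣ a ∣ ℚ.≤ K → ℚ.∣ b ∣ ℚ.≤ δ → ℚ.∣ a ℚ.* b ∣ ℚ.≤ K ℚ.* δ
  ∣*∣≤ {K} {δ} a b 0<K a≤K b≤δ = begin
    ℚ.∣ a ℚ.* b ∣          ≡⟨ ℚ.∣p*q∣≡∣p∣*∣q∣ a b ⟩
    ℚ.∣ a ∣ ℚ.* ℚ.∣ b ∣    ≤⟨ ℚ.*-monoʳ-≤-nonNeg ℚ.∣ b ∣ {{ℚ.∣-∣-nonNeg b}} a≤K ⟩
    K ℚ.* ℚ.∣ b ∣          ≤⟨ ℚ.*-monoˡ-≤-nonNeg K {{ℚ.pos⇒nonNeg K {{ℚ.positive 0<K}}}} b≤δ ⟩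
    K ℚ.* δ                ∎
    where open ℚ.≤-Reasoning

  bounded : ∀ x → ∃ λ K → 0ℚ ℚ.< K × Eventually λ n → ℚ.∣ seq x n ∣ ℚ.≤ K
  bounded (mkℝ x c) with c 1ℚ (ℚ.positive⁻¹ 1ℚ)
  ... | N , close = 1ℚ ℚ.+ ℚ.∣ x N ∣ ,
        ℚ.+-mono-<-≤ (ℚ.positive⁻¹ 1ℚ) (ℚ.0≤∣p∣ (x N)) ,
        N , λ n N≤n → begin
          ℚ.∣ x n ∣
            ≡⟨ cong ℚ.∣_∣ (solve 2 (λ a b → a := a :- b :+ b) refl (x n) (x N)) ⟩
          ℚ.∣ x n ℚ.- x N ℚ.+ x N ∣
            ≤⟨ ℚ.∣p+q∣≤∣p∣+∣q∣ (x n ℚ.- x N) (x N) ⟩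
          ℚ.∣ x n ℚ.- x N ∣ ℚ.+ ℚ.∣ x N ∣
            ≤⟨ ℚ.+-monoˡ-≤ ℚ.∣ x N ∣ (ℚ.<⇒≤ (close n N N≤n ℕ.≤-refl)) ⟩
          1ℚ ℚ.+ ℚ.∣ x N ∣ ∎
    where
    open ℚ.≤-Reasoning
    open ℚ-Solver

  null-* : ∀ x {s : ℕ → ℚ} → Null s → Null (λ n → seq x n ℚ.* s n)
  null-* x {s} null ε 0<ε =
    let K , 0<K , x≤K = bounded x
        δ , 0<δ , Kδ≡ε = quotient K ε 0<K 0<ε
    in zipEventually (λ n p q → ℚ.≤-trans (∣*∣≤ (seq x n) (s n) 0<K p q) (ℚ.≤-reflexive Kδ≡ε)) x≤K (null δ 0<δ)

  ≗⇒≃ : ∀ {x y} → (∀ n → seq x n ≡ seq y n) → x ≃ y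
  ≗⇒≃ {x} {y} eq = null⇒≃ x y λ ε 0<ε → always λ n →
    subst (λ q → ℚ.∣ q ∣ ℚ.≤ ε)
      (sym (trans (cong (ℚ._- seq y n) (eq n)) (ℚ.+-inverseʳ (seq y n)))) (ℚ.<⇒≤ 0<ε)

  ≤ℝ-trans : ∀ {x y z} → x ≤ℝ y → y ≤ℝ z → x ≤ℝ z
  ≤ℝ-trans {x} {y} {z} x≤y y≤z ε 0<ε with half ε 0<ε
  ... | δ , 0<δ , refl = zipEventually
    (λ n p q → ℚ.≤-trans p (subst (seq y n ℚ.+ δ ℚ.≤_) (ℚ.+-assoc (seq z n) δ δ) (ℚ.+-monoˡ-≤ δ q)))
    (x≤y δ 0<δ) (y≤z δ 0<δ)

  ≃-sym : ∀ {x y} → x ≃ y → y ≃ x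
  ≃-sym (p , q) = q , p

  ≃-trans : ∀ {x y z} → x ≃ y → y ≃ z → x ≃ z
  ≃-trans {x} {y} {z} (p , q) (r , s) = ≤ℝ-trans {x} {y} {z} p r , ≤ℝ-trans {z} {y} {x} s q

  +ℝ-cong : ∀ {x y u v} → x ≃ y → u ≃ v → x +ℝ u ≃ y +ℝ v
  +ℝ-cong {x} {y} {u} {v} x≃y u≃v = null⇒≃ (x +ℝ u) (y +ℝ v) (null-resp
    (λ n → solve 4 (λ x y u v → (x :- y) :+ (u :- v) := (x :+ u) :- (y :+ v)) refl
      (seq x n) (seq y n) (seq u n) (seq v n))
    (null-+ (≃⇒null x y x≃y) (≃⇒null u v u≃v)))
    where open ℚ-Solver

  *ℝ-cong : ∀ {x y u v} → x ≃ y → u ≃ v → x *ℝ u ≃ y *ℝ v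
  *ℝ-cong {x} {y} {u} {v} x≃y u≃v = null⇒≃ (x *ℝ u) (y *ℝ v) (null-resp
    (λ n → solve 4 (λ x y u v → u :* (x :- y) :+ y :* (u :- v) := x :* u :- y :* v) refl
      (seq x n) (seq y n) (seq u n) (seq v n))
    (null-+ (null-* u (≃⇒null x y x≃y)) (null-* y (≃⇒null u v u≃v))))
    where open ℚ-Solver

  commutativeSemiring : CommutativeSemiring 0ℓ 0ℓ
  commutativeSemiring = record
    { Carrier = ℝ ; _≈_ = _≃_ ; _+_ = _+ℝ_ ; _*_ = _*ℝ_ ; 0# = 0ℝ ; 1# = 1ℝ
    ; isCommutativeSemiring = record
      { isSemiring = record
        { isSemiringWithoutAnnihilatingZero = record
          { +-isCommutativeMonoid = record
            { isMonoid = record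
              { isSemigroup = record
                { isMagma = record
                  { isEquivalence = record
                    { refl = λ {x} → ≗⇒≃ {x} {x} λ _ → refl
                    ; sym = λ {x} {y} → ≃-sym {x} {y}
                    ; trans = λ {x} {y} {z} → ≃-trans {x} {y} {z} }
                  ; ∙-cong = λ {x} {y} {u} {v} → +ℝ-cong {x} {y} {u} {v} }
                ; assoc = λ x y z → ≗⇒≃ {(x +ℝ y) +ℝ z} {x +ℝ (y +ℝ z)}
                    λ n → ℚ.+-assoc (seq x n) (seq y n) (seq z n) }
              ; identity = (λ x → ≗⇒≃ {0ℝ +ℝ x} {x} λ n → ℚ.+-identityˡ (seq x n))
                         , (λ x → ≗⇒≃ {x +ℝ 0ℝ} {x} λ n → ℚ.+-identityʳ (seq x n)) }
            ; comm = λ x y → ≗⇒≃ {x +ℝ y} {y +ℝ x} λ n → ℚ.+-comm (seq x n) (seq y n) }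
          ; *-cong = λ {x} {y} {u} {v} → *ℝ-cong {x} {y} {u} {v}
          ; *-assoc = λ x y z → ≗⇒≃ {(x *ℝ y) *ℝ z} {x *ℝ (y *ℝ z)}
              λ n → ℚ.*-assoc (seq x n) (seq y n) (seq z n)
          ; *-identity = (λ x → ≗⇒≃ {1ℝ *ℝ x} {x} λ n → ℚ.*-identityˡ (seq x n))
                       , (λ x → ≗⇒≃ {x *ℝ 1ℝ} {x} λ n → ℚ.*-identityʳ (seq x n))
          ; distrib = (λ x y z → ≗⇒≃ {x *ℝ (y +ℝ z)} {x *ℝ y +ℝ x *ℝ z}
                         λ n → ℚ.*-distribˡ-+ (seq x n) (seq y n) (seq z n))
                    , (λ x y z → ≗⇒≃ {(y +ℝ z) *ℝ x} {y *ℝ x +ℝ z *ℝ x}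
                         λ n → ℚ.*-distribʳ-+ (seq x n) (seq y n) (seq z n)) }
        ; zero = (λ x → ≗⇒≃ {0ℝ *ℝ x} {0ℝ} λ n → ℚ.*-zeroˡ (seq x n))
               , (λ x → ≗⇒≃ {x *ℝ 0ℝ} {0ℝ} λ n → ℚ.*-zeroʳ (seq x n)) }
      ; *-comm = λ x y → ≗⇒≃ {x *ℝ y} {y *ℝ x} λ n → ℚ.*-comm (seq x n) (seq y n) } }

  +-nonNegative : ∀ {x y} → 0ℝ ≤ℝ x → 0ℝ ≤ℝ y → 0ℝ ≤ℝ x +ℝ y
  +-nonNegative {x} {y} 0≤x 0≤y ε 0<ε with half ε 0<ε
  ... | δ , 0<δ , refl = zipEventually
    (λ n p q → subst (0ℚ ℚ.≤_)
      (solve 3 (λ x y d → (x :+ d) :+ (y :+ d) := (x :+ y) :+ (d :+ d)) refl (seq x n) (seq y n) δ)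
      (ℚ.+-mono-≤ p q))
    (0≤x δ 0<δ) (0≤y δ 0<δ)
    where open ℚ-Solver

  private
    -- For x ≥ 0 expand x (y + δ) ≥ 0; for x ≤ 0 the factor x lies between -δ and 0, so the product
    -- is within K δ of 0.
    product-lower-bound : ∀ {K δ} x y → 0ℚ ℚ.< K → 0ℚ ℚ.< δ →
      0ℚ ℚ.≤ x ℚ.+ δ → 0ℚ ℚ.≤ y ℚ.+ δ → ℚ.∣ x ∣ ℚ.≤ K → ℚ.∣ y ∣ ℚ.≤ K →
      0ℚ ℚ.≤ x ℚ.* y ℚ.+ K ℚ.* δ
    product-lower-bound {K} {δ} x y 0<K 0<δ -δ≤x -δ≤y x≤K y≤K with ℚ.≤-total 0ℚ x
    ... | inj₁ 0≤x = begin
        0ℚ                    ≡⟨ ℚ.*-zeroʳ x ⟨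
        x ℚ.* 0ℚ              ≤⟨ ℚ.*-monoˡ-≤-nonNeg x {{ℚ.nonNegative 0≤x}} -δ≤y ⟩
        x ℚ.* (y ℚ.+ δ)       ≡⟨ ℚ.*-distribˡ-+ x y δ ⟩
        x ℚ.* y ℚ.+ x ℚ.* δ   ≤⟨ ℚ.+-monoʳ-≤ (x ℚ.* y) (ℚ.*-monoʳ-≤-nonNeg δ
                                  {{ℚ.pos⇒nonNeg δ {{ℚ.positive 0<δ}}}} (ℚ.≤-trans (p≤∣p∣ x) x≤K)) ⟩
        x ℚ.* y ℚ.+ K ℚ.* δ   ∎
      where open ℚ.≤-Reasoning
    ... | inj₂ x≤0 = begin
        0ℚ                            ≡⟨ solve 1 (λ z → con 0ℚ := z :- z) refl (x ℚ.* y) ⟩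
        x ℚ.* y ℚ.- x ℚ.* y           ≤⟨ ℚ.+-monoʳ-≤ (x ℚ.* y) (ℚ.≤-trans (-p≤∣p∣ (x ℚ.* y))
                                          (subst (λ z → ℚ.∣ z ∣ ℚ.≤ K ℚ.* δ) (ℚ.*-comm y x)
                                            (∣*∣≤ y x 0<K y≤K (∣∣≤ (ℚ.≤-trans x≤0 (ℚ.<⇒≤ 0<δ)) -x≤δ)))) ⟩
        x ℚ.* y ℚ.+ K ℚ.* δ           ∎
      where
      open ℚ.≤-Reasoning
      open ℚ-Solver
      -x≤δ : ℚ.- x ℚ.≤ δ
      -x≤δ = subst₂ ℚ._≤_ (ℚ.+-identityʳ (ℚ.- x))
        (solve 2 (λ x d → :- x :+ (x :+ d) := d) refl x δ) (ℚ.+-monoʳ-≤ (ℚ.- x) -δ≤x)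

  *-nonNegative : ∀ {x y} → 0ℝ ≤ℝ x → 0ℝ ≤ℝ y → 0ℝ ≤ℝ x *ℝ y
  *-nonNegative {x} {y} 0≤x 0≤y ε 0<ε =
    let K , 0<K , x≤K = bounded x
        L , 0<L , y≤L = bounded y
        K≤K+L = subst (ℚ._≤ K ℚ.+ L) (ℚ.+-identityʳ K) (ℚ.+-monoʳ-≤ K (ℚ.<⇒≤ 0<L))
        L≤K+L = subst (ℚ._≤ K ℚ.+ L) (ℚ.+-identityˡ L) (ℚ.+-monoˡ-≤ L (ℚ.<⇒≤ 0<K))
        δ , 0<δ , eq = quotient (K ℚ.+ L) ε (ℚ.+-mono-< 0<K 0<L) 0<ε
    in zipEventually
      (λ n (p , p′) (q , q′) → subst (λ z → 0ℚ ℚ.≤ seq x n ℚ.* seq y n ℚ.+ z) eq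
        (product-lower-bound (seq x n) (seq y n) (ℚ.+-mono-< 0<K 0<L) 0<δ p q
          (ℚ.≤-trans p′ K≤K+L) (ℚ.≤-trans q′ L≤K+L)))
      (zipEventually (λ _ → _,_) (0≤x δ 0<δ) x≤K)
      (zipEventually (λ _ → _,_) (0≤y δ 0<δ) y≤L)

  -1ℝ : ℝ
  -1ℝ = fromℚ (ℚ.- 1ℚ)

  -- A late term decides: if it exceeds δ, all later terms are nonnegative and 0 ≤ x after all;
  -- otherwise all later terms are at most δ + δ = ε. Only rationals are compared, so the conclusion
  -- carries no double negation.
  negative⇒-nonNegative : ∀ x → ¬ (0ℝ ≤ℝ x) → 0ℝ ≤ℝ -1ℝ *ℝ x
  negative⇒-nonNegative x 0≰x ε 0<ε with half ε 0<ε
  ... | δ , 0<δ , refl with cauchy x δ 0<δ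
  ... | N , close with seq x N ℚ.≤? δ
  ... | yes xN≤δ = N , λ n N≤n → subst (ℚ._≤ ℚ.- 1ℚ ℚ.* seq x n ℚ.+ (δ ℚ.+ δ))
        (ℚ.+-inverseˡ (seq x n))
        (subst₂ ℚ._≤_
          refl (solve 2 (λ x d → :- x :+ (d :+ d) := con (ℚ.- 1ℚ) :* x :+ (d :+ d)) refl (seq x n) δ)
          (ℚ.+-monoʳ-≤ (ℚ.- seq x n)
            (ℚ.≤-trans (x-y≤ε⇒x≤y+ε (seq x n) (seq x N) δ
              (ℚ.≤-trans (p≤∣p∣ _) (ℚ.<⇒≤ (close n N N≤n ℕ.≤-refl))))
              (ℚ.+-monoˡ-≤ δ xN≤δ))))
    where open ℚ-Solver
  ... | no xN≰δ = contradiction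
        (λ η 0<η → N , λ n N≤n →
          ℚ.≤-trans (nonNeg n N≤n)
            (subst (ℚ._≤ seq x n ℚ.+ η) (ℚ.+-identityʳ (seq x n)) (ℚ.+-monoʳ-≤ (seq x n) (ℚ.<⇒≤ 0<η))))
        0≰x
    where
    open ℚ-Solver
    nonNeg : ∀ n → N ℕ.≤ n → 0ℚ ℚ.≤ seq x n
    nonNeg n N≤n = subst₂ ℚ._≤_ (ℚ.+-inverseˡ δ)
      (solve 2 (λ x d → :- d :+ (x :+ d) := x) refl (seq x n) δ)
      (ℚ.+-monoʳ-≤ (ℚ.- δ) (ℚ.≤-trans (ℚ.<⇒≤ (ℚ.≰⇒> xN≰δ))
        (x-y≤ε⇒x≤y+ε (seq x N) (seq x n) δ
          (ℚ.≤-trans (p≤∣p∣ _) (ℚ.<⇒≤ (close N n ℕ.≤-refl N≤n))))))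

  -- The positive form of being nonzero: explicit lower bounds can be multiplied.
  Apart : ℝ → Set
  Apart x = ∃ λ ε → 0ℚ ℚ.< ε × Eventually λ n → ε ℚ.≤ ℚ.∣ seq x n ∣

  -- Write ε = 4 θ and take a late term. If it exceeds 2 θ in absolute value, all later ones exceed
  -- θ and x is apart from 0; otherwise all later ones are at most 3 θ.
  ¬apart⇒≃0 : ∀ x → ¬ Apart x → x ≃ 0ℝ
  ¬apart⇒≃0 x ¬apart = null⇒≃ x 0ℝ (null-resp (λ n → sym (ℚ.+-identityʳ (seq x n))) null)
    where
    open ℚ-Solver
    triangle : ∀ a b {η} → ℚ.∣ a ℚ.- b ∣ ℚ.< η → ℚ.∣ a ∣ ℚ.≤ ℚ.∣ b ∣ ℚ.+ η
    triangle a b {η} close = begin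
      ℚ.∣ a ∣                       ≡⟨ cong ℚ.∣_∣ (solve 2 (λ a b → a := b :+ (a :- b)) refl a b) ⟩
      ℚ.∣ b ℚ.+ (a ℚ.- b) ∣         ≤⟨ ℚ.∣p+q∣≤∣p∣+∣q∣ b (a ℚ.- b) ⟩
      ℚ.∣ b ∣ ℚ.+ ℚ.∣ a ℚ.- b ∣     ≤⟨ ℚ.+-monoʳ-≤ ℚ.∣ b ∣ (ℚ.<⇒≤ close) ⟩
      ℚ.∣ b ∣ ℚ.+ η                 ∎
      where open ℚ.≤-Reasoning
    null : Null (seq x)
    null ε 0<ε with half ε 0<ε
    ... | η , 0<η , refl with half η 0<η
    ... | θ , 0<θ , refl with cauchy x θ 0<θ
    ... | N , close with ℚ.∣ seq x N ∣ ℚ.≤? θ ℚ.+ θ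
    ... | yes small = N , λ n N≤n → ℚ.≤-trans (triangle (seq x n) (seq x N) (close n N N≤n ℕ.≤-refl))
          (ℚ.+-mono-≤ small (subst (ℚ._≤ θ ℚ.+ θ) (ℚ.+-identityʳ θ) (ℚ.+-monoʳ-≤ θ (ℚ.<⇒≤ 0<θ))))
    ... | no big = contradiction (θ , 0<θ , N , λ n N≤n →
          subst₂ ℚ._≤_ (solve 1 (λ t → t :+ t :- t := t) refl θ)
            (solve 2 (λ a t → a :+ t :- t := a) refl ℚ.∣ seq x n ∣ θ)
            (ℚ.+-monoˡ-≤ (ℚ.- θ) (ℚ.≤-trans (ℚ.<⇒≤ (ℚ.≰⇒> big))
              (triangle (seq x N) (seq x n) (close N n ℕ.≤-refl N≤n))))) ¬apart

  apart-* : ∀ x y → Apart x → Apart y → Apart (x *ℝ y)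
  apart-* x y (ε , 0<ε , ε≤x) (δ , 0<δ , δ≤y) = ε ℚ.* δ , *-pos 0<ε 0<δ , zipEventually
    (λ n p q → begin
      ε ℚ.* δ                              ≤⟨ ℚ.*-monoˡ-≤-nonNeg ε {{ℚ.pos⇒nonNeg ε {{ℚ.positive 0<ε}}}} q ⟩
      ε ℚ.* ℚ.∣ seq y n ∣                  ≤⟨ ℚ.*-monoʳ-≤-nonNeg ℚ.∣ seq y n ∣ {{ℚ.∣-∣-nonNeg (seq y n)}} p ⟩
      ℚ.∣ seq x n ∣ ℚ.* ℚ.∣ seq y n ∣      ≡⟨ ℚ.∣p*q∣≡∣p∣*∣q∣ (seq x n) (seq y n) ⟨
      ℚ.∣ seq x n ℚ.* seq y n ∣            ∎) ε≤x δ≤y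
    where open ℚ.≤-Reasoning

  apart⇒≄0 : ∀ x → Apart x → ¬ x ≃ 0ℝ
  apart⇒≄0 x (ε , 0<ε , N , ε≤x) x≃0 =
    let δ , 0<δ , eq = half ε 0<ε
        M , x≤δ = null-resp (λ n → ℚ.+-identityʳ (seq x n)) (≃⇒null x 0ℝ x≃0) δ 0<δ
    in ℚ.<-irrefl refl (ℚ.<-≤-trans
        (subst₂ ℚ._<_ (ℚ.+-identityʳ δ) eq (ℚ.+-monoʳ-< δ 0<δ))
        (ℚ.≤-trans (ε≤x (N ℕ.⊔ M) (ℕ.m≤m⊔n N M)) (x≤δ (N ℕ.⊔ M) (ℕ.m≤n⊔m N M))))

  -- The goal is a negation, so lower bounds for both factors may be assumed although neither
  -- hypothesis contains one.
  *-nonZero : ∀ x y → ¬ x ≃ 0ℝ → ¬ y ≃ 0ℝ → ¬ x *ℝ y ≃ 0ℝ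
  *-nonZero x y x≄0 y≄0 xy≃0 = x≄0 (¬apart⇒≃0 x λ x#0 → y≄0 (¬apart⇒≃0 y λ y#0 →
    apart⇒≄0 (x *ℝ y) (apart-* x y x#0 y#0) xy≃0))

  fromℕ-suc : ∀ k → + suc k ℚ./ 1 ≡ 1ℚ ℚ.+ + k ℚ./ 1
  fromℕ-suc k = ℚ.toℚᵘ-injective (begin-equality
      ℚ.toℚᵘ (+ suc k ℚ./ 1)                 ≃⟨ ℚ.toℚᵘ-fromℚᵘ (ℚᵘ.mkℚᵘ (+ suc k) 0) ⟩
      ℚᵘ.mkℚᵘ (+ suc k) 0                    ≃⟨ ℚᵘ.*≡* (cong (λ z → (+ 1 ℤ.+ z) ℤ.* + 1) (sym (ℤ.*-identityʳ (+ k)))) ⟩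
      ℚ.toℚᵘ 1ℚ ℚᵘ.+ ℚᵘ.mkℚᵘ (+ k) 0         ≃⟨ ℚᵘ.+-congʳ (ℚ.toℚᵘ 1ℚ) (ℚ.toℚᵘ-fromℚᵘ (ℚᵘ.mkℚᵘ (+ k) 0)) ⟨
      ℚ.toℚᵘ 1ℚ ℚᵘ.+ ℚ.toℚᵘ (+ k ℚ./ 1)      ≃⟨ ℚ.toℚᵘ-homo-+ 1ℚ (+ k ℚ./ 1) ⟨
      ℚ.toℚᵘ (1ℚ ℚ.+ + k ℚ./ 1)              ∎)
    where open ℚᵘ.≤-Reasoning

  fromℕ-mono : ∀ {k l} → k ℕ.≤ l → + k ℚ./ 1 ℚ.≤ + l ℚ./ 1
  fromℕ-mono {k} {l} k≤l = ℚ.toℚᵘ-cancel-≤ (ℚᵘ.≤-respʳ-≃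
    (ℚᵘ.≃-sym (ℚ.toℚᵘ-fromℚᵘ (ℚᵘ.mkℚᵘ (+ l) 0)))
    (ℚᵘ.≤-respˡ-≃ (ℚᵘ.≃-sym (ℚ.toℚᵘ-fromℚᵘ (ℚᵘ.mkℚᵘ (+ k) 0)))
      (ℚᵘ.*≤* (ℤ.*-monoʳ-≤-nonNeg (+ 1) (ℤ.+≤+ k≤l)))))

  archimedean-ℚ : ∀ q → ∃ λ k → q ℚ.≤ + k ℚ./ 1
  archimedean-ℚ q@(ℚ.mkℚ (+ a) b _) = a , ℚ.toℚᵘ-cancel-≤ (ℚᵘ.≤-respʳ-≃
    (ℚᵘ.≃-sym (ℚ.toℚᵘ-fromℚᵘ (ℚᵘ.mkℚᵘ (+ a) 0)))
    (ℚᵘ.*≤* (ℤ.*-monoˡ-≤-nonNeg (+ a) (ℤ.+≤+ (ℕ.s≤s ℕ.z≤n)))))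
  archimedean-ℚ q@(ℚ.mkℚ (ℤ.-[1+ a ]) b _) = 0 , ℚ.<⇒≤ (ℚ.negative⁻¹ q)

  archimedean : ∀ x → ∃ λ k → 0ℝ ≤ℝ fromℕ k +ℝ x
  archimedean x =
    let K , 0<K , x≤K = bounded x
        k , K≤k = archimedean-ℚ K
    in k , λ ε 0<ε → mapEventually
      (λ n p → ℚ.+-mono-≤ (subst (ℚ._≤ + k ℚ./ 1 ℚ.+ seq x n) (ℚ.+-inverseˡ (seq x n))
        (ℚ.+-monoˡ-≤ (seq x n) (ℚ.≤-trans (-p≤∣p∣ (seq x n)) (ℚ.≤-trans p K≤k)))) (ℚ.<⇒≤ 0<ε))
      x≤K

  reciprocal : ∀ k → ∃ λ y → fromℕ (suc k) *ℝ y ≃ 1ℝ × 0ℝ ≤ℝ y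
  reciprocal k =
    let q , 0<q , eq = quotient (+ suc k ℚ./ 1) 1ℚ
          (ℚ.<-≤-trans (ℚ.positive⁻¹ 1ℚ) (fromℕ-mono {1} {suc k} (ℕ.s≤s ℕ.z≤n))) (ℚ.positive⁻¹ 1ℚ)
    in fromℚ q , ≗⇒≃ {fromℕ (suc k) *ℝ fromℚ q} {1ℝ} (λ _ → eq) ,
       λ ε 0<ε → always λ _ → ℚ.+-mono-≤ (ℚ.<⇒≤ 0<q) (ℚ.<⇒≤ 0<ε)

  1≄0 : ¬ 1ℝ ≃ 0ℝ
  1≄0 = apart⇒≄0 1ℝ (1ℚ , ℚ.positive⁻¹ 1ℚ , always λ _ → ℚ.≤-refl)

  -- The number r (k + 1) competes for the floor in the k-th term, because (r (k + 1)) ^ d ≤ N (k +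
  -- 1) ^ d.
  root-lower-bound : ∀ d N r k .{{_ : ℕ.NonZero d}} → r ℕ.^ d ℕ.≤ N → + r ℚ./ 1 ℚ.≤ rootSeq d N k
  root-lower-bound d N r k r^d≤N = ℚ.toℚᵘ-cancel-≤ (ℚᵘ.≤-respʳ-≃
      (ℚᵘ.≃-sym (ℚ.toℚᵘ-fromℚᵘ (ℚᵘ.mkℚᵘ (+ s) k)))
      (ℚᵘ.≤-respˡ-≃ (ℚᵘ.≃-sym (ℚ.toℚᵘ-fromℚᵘ (ℚᵘ.mkℚᵘ (+ r) 0)))
        (ℚᵘ.*≤* (subst₂ ℤ._≤_ (ℤ.pos-* r (suc k)) (sym (ℤ.*-identityʳ (+ s))) (ℤ.+≤+ r*≤s)))))
    where
    s = ⌊root⌋ d (N ℕ.* suc k ℕ.^ d)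
    r*≤s : r ℕ.* suc k ℕ.≤ s
    r*≤s with r ℕ.* suc k ℕ.≤? s
    ... | yes p = p
    ... | no ¬p = contradiction
      (ℕ.≤-<-trans (ℕ.*-monoˡ-≤ (suc k ℕ.^ d) r^d≤N)
        (ℕ.<-≤-trans (⌊root⌋-upper d (N ℕ.* suc k ℕ.^ d))
          (subst (suc s ℕ.^ d ℕ.≤_) (^-distribʳ-* d r (suc k)) (ℕ.^-monoˡ-≤ d (ℕ.≰⇒> ¬p)))))
      (ℕ.<-irrefl refl)

  fromℕ-* : ∀ j k → + (j ℕ.* k) ℚ./ 1 ≡ + j ℚ./ 1 ℚ.* (+ k ℚ./ 1)
  fromℕ-* j k = ℚ.toℚᵘ-injective (begin-equality
      ℚ.toℚᵘ (+ (j ℕ.* k) ℚ./ 1)                    ≃⟨ ℚ.toℚᵘ-fromℚᵘ (ℚᵘ.mkℚᵘ (+ (j ℕ.* k)) 0) ⟩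
      ℚᵘ.mkℚᵘ (+ (j ℕ.* k)) 0                       ≃⟨ ℚᵘ.*≡* (cong (ℤ._* + 1) (ℤ.pos-* j k)) ⟩
      ℚᵘ.mkℚᵘ (+ j) 0 ℚᵘ.* ℚᵘ.mkℚᵘ (+ k) 0          ≃⟨ ℚᵘ.*-cong (ℚ.toℚᵘ-fromℚᵘ (ℚᵘ.mkℚᵘ (+ j) 0))
                                                                     (ℚ.toℚᵘ-fromℚᵘ (ℚᵘ.mkℚᵘ (+ k) 0)) ⟨
      ℚ.toℚᵘ (+ j ℚ./ 1) ℚᵘ.* ℚ.toℚᵘ (+ k ℚ./ 1)    ≃⟨ ℚ.toℚᵘ-homo-* (+ j ℚ./ 1) (+ k ℚ./ 1) ⟨
      ℚ.toℚᵘ (+ j ℚ./ 1 ℚ.* (+ k ℚ./ 1))              ∎)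
    where open ℚᵘ.≤-Reasoning

  -- Lets the colouring argument stay within the natural numbers: a witness r with r ^ d ≤ N stands
  -- for the real root.
  fromℕ-≤-root : ∀ d N K m r .{{_ : ℕ.NonZero d}} → r ℕ.^ d ℕ.≤ N → m ℕ.≤ K ℕ.* r →
    fromℕ m ≤ℝ fromℕ K *ℝ root d N
  fromℕ-≤-root d N K m r r^d≤N m≤K*r ε 0<ε = always λ k → begin
      + m ℚ./ 1                                    ≤⟨ fromℕ-mono m≤K*r ⟩
      + (K ℕ.* r) ℚ./ 1                            ≡⟨ fromℕ-* K r ⟩
      + K ℚ./ 1 ℚ.* (+ r ℚ./ 1)                      ≤⟨ ℚ.*-monoˡ-≤-nonNeg (+ K ℚ./ 1)
        {{ℚ.nonNegative (fromℕ-mono {0} {K} ℕ.z≤n)}} (root-lower-bound d N r k r^d≤N) ⟩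
      + K ℚ./ 1 ℚ.* rootSeq d N k                  ≡⟨ ℚ.+-identityʳ (+ K ℚ./ 1 ℚ.* rootSeq d N k) ⟨
      + K ℚ./ 1 ℚ.* rootSeq d N k ℚ.+ 0ℚ           ≤⟨ ℚ.+-monoʳ-≤ (+ K ℚ./ 1 ℚ.* rootSeq d N k) (ℚ.<⇒≤ 0<ε) ⟩
      + K ℚ./ 1 ℚ.* rootSeq d N k ℚ.+ ε            ∎
    where open ℚ.≤-Reasoning

-- Finite sets and double negation

subsets : ∀ n → List (Subset n)
subsets zero    = [] ∷ []
subsets (suc n) = map (inside ∷_) (subsets n) ++ map (outside ∷_) (subsets n)

∈-subsets : ∀ {n} (s : Subset n) → s ∈ˡ subsets n
∈-subsets []            = here ≡.refl
∈-subsets (inside ∷ s)  = ∈-++⁺ˡ (∈-map⁺ (inside ∷_) (∈-subsets s))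
∈-subsets (outside ∷ s) = ∈-++⁺ʳ (map (inside ∷_) (subsets _)) (∈-map⁺ (outside ∷_) (∈-subsets s))

∣s∣≤1+∣s-x∣ : ∀ {n} (s : Subset n) x → ∣ s ∣ ℕ.≤ suc ∣ s - x ∣
∣s∣≤1+∣s-x∣ (inside ∷ s)  zero    = ℕ.s≤s (ℕ.≤-reflexive (≡.cong ∣_∣ (≡.sym (p─⊥≡p s))))
∣s∣≤1+∣s-x∣ (outside ∷ s) zero    = ℕ.m≤n⇒m≤1+n (ℕ.≤-reflexive (≡.cong ∣_∣ (≡.sym (p─⊥≡p s))))
∣s∣≤1+∣s-x∣ (inside ∷ s)  (suc x) = ℕ.s≤s (∣s∣≤1+∣s-x∣ s x)
∣s∣≤1+∣s-x∣ (outside ∷ s) (suc x) = ∣s∣≤1+∣s-x∣ s x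

x∉s-x : ∀ {n} (s : Subset n) x → x ∉ s - x
x∉s-x (inside ∷ s)  zero    ()
x∉s-x (outside ∷ s) zero    ()
x∉s-x (_ ∷ s)       (suc x) (there h) = x∉s-x s x h

∣p∩q∣+∣p∩∁q∣≡∣p∣ : ∀ {n} (p q : Subset n) → ∣ p ∩ q ∣ ℕ.+ ∣ p ∩ ∁ q ∣ ≡ ∣ p ∣
∣p∩q∣+∣p∩∁q∣≡∣p∣ []            []            = ≡.refl
∣p∩q∣+∣p∩∁q∣≡∣p∣ (outside ∷ p) (_ ∷ q)       = ∣p∩q∣+∣p∩∁q∣≡∣p∣ p q
∣p∩q∣+∣p∩∁q∣≡∣p∣ (inside ∷ p)  (inside ∷ q)  = ≡.cong suc (∣p∩q∣+∣p∩∁q∣≡∣p∣ p q)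
∣p∩q∣+∣p∩∁q∣≡∣p∣ (inside ∷ p)  (outside ∷ q) =
  ≡.trans (ℕ.+-suc ∣ p ∩ q ∣ ∣ p ∩ ∁ q ∣) (≡.cong suc (∣p∩q∣+∣p∩∁q∣≡∣p∣ p q))

0<∣s∣⇒nonempty : ∀ {n} (s : Subset n) → 0 ℕ.< ∣ s ∣ → Nonempty s
0<∣s∣⇒nonempty (inside ∷ s)  _ = zero , here
0<∣s∣⇒nonempty (outside ∷ s) h = let v , v∈s = 0<∣s∣⇒nonempty s h in suc v , there v∈s

¬¬-∀-Fin : ∀ {n} {P : Fin n → Set} → (∀ i → ¬ ¬ P i) → ¬ ¬ (∀ i → P i)
¬¬-∀-Fin {zero}  h k = k λ ()
¬¬-∀-Fin {suc n} h k = h zero λ p₀ → ¬¬-∀-Fin (h ∘ suc) λ p → k λ { zero → p₀ ; (suc i) → p i }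

¬¬-∀-Subset : ∀ {n} {P : Subset n → Set} → (∀ s → ¬ ¬ P s) → ¬ ¬ (∀ s → P s)
¬¬-∀-Subset {zero}  h k = h [] λ p → k λ { [] → p }
¬¬-∀-Subset {suc n} h k = ¬¬-∀-Subset (h ∘ (inside ∷_)) λ p → ¬¬-∀-Subset (h ∘ (outside ∷_)) λ q →
  k λ { (inside ∷ s) → p s ; (outside ∷ s) → q s }

-- Double negation commutes with finite conjunctions, so finitely many undecided alternatives can be
-- settled at once. It serves to split an edge by the signs of its coefficients.
¬¬-separate : ∀ {n} {A B : Fin n → Set} → (∀ v → ¬ ¬ (A v ⊎ B v)) →
  ¬ ¬ ∃ λ s → (∀ v → v ∈ s → A v) × (∀ v → v ∉ s → B v)
¬¬-separate {n} {A} {B} h k = ¬¬-∀-Fin h λ choice → k (tabulate (isA choice) , in-s choice , out-s choice)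
  where
  isLeft : ∀ {v} → A v ⊎ B v → Bool
  isLeft = [ (λ _ → true) , (λ _ → false) ]′
  isA : (∀ v → A v ⊎ B v) → Fin n → Bool
  isA choice v = isLeft (choice v)
  fromLeft : ∀ {v} (c : A v ⊎ B v) → isLeft c ≡ true → A v
  fromLeft (inj₁ a) _ = a
  fromRight : ∀ {v} (c : A v ⊎ B v) → isLeft c ≢ true → B v
  fromRight (inj₁ _) h = contradiction ≡.refl h
  fromRight (inj₂ b) _ = b
  in-s : ∀ choice v → v ∈ tabulate (isA choice) → A v
  in-s choice v v∈ = fromLeft (choice v)
    (≡.trans (≡.sym (lookup∘tabulate (isA choice) v)) ([]=⇒lookup v∈))
  out-s : ∀ choice v → v ∉ tabulate (isA choice) → B v
  out-s choice v v∉ = fromRight (choice v)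
    λ eq → v∉ (lookup⇒[]= v (tabulate (isA choice)) (≡.trans (lookup∘tabulate (isA choice) v) eq))

-- Linear algebra

-- Negation is multiplication by -1#, so that the solver for commutative semirings applies.
-- The order is only decidable up to double negation, as it is for Cauchy reals.
record OrderedRing : Set₁ where
  field
    commutativeSemiring : CommutativeSemiring 0ℓ 0ℓ
  open CommutativeSemiring commutativeSemiring public hiding (zero)
  field
    -1#         : Carrier
    1-1≈0       : 1# + -1# ≈ 0#
    NonNeg      : Carrier → Set
    NonNeg-resp : ∀ {x y} → x ≈ y → NonNeg x → NonNeg y
    NonNeg-0    : NonNeg 0#
    NonNeg-+    : ∀ {x y} → NonNeg x → NonNeg y → NonNeg (x + y)
    NonNeg-*    : ∀ {x y} → NonNeg x → NonNeg y → NonNeg (x * y)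
    sign        : ∀ x → ¬ ¬ (NonNeg x ⊎ NonNeg (-1# * x))
    1≉0         : ¬ 1# ≈ 0#
    *-nonZero   : ∀ {x y} → ¬ x ≈ 0# → ¬ y ≈ 0# → ¬ x * y ≈ 0#
    ι           : ℕ → Carrier
    ι-zero      : ι zero ≈ 0#
    ι-suc       : ∀ k → ι (suc k) ≈ 1# + ι k
    reciprocal  : ∀ k → ∃ λ y → ι (suc k) * y ≈ 1# × NonNeg y
    archimedean : ∀ x → ∃ λ k → NonNeg (ι k + x)

module LinearAlgebra (F : OrderedRing) where
  open OrderedRing F
  open Semiring-Sum semiring public
  open NaturalCoefficients commutativeSemiring public
  open import Relation.Binary.Reasoning.Setoid setoid public

  cancel : ∀ x → x + -1# * x ≈ 0#
  cancel x = begin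
    x + -1# * x        ≈⟨ +-congʳ (*-identityˡ x) ⟨
    1# * x + -1# * x   ≈⟨ distribʳ x 1# -1# ⟨
    (1# + -1#) * x     ≈⟨ *-congʳ 1-1≈0 ⟩
    0# * x             ≈⟨ zeroˡ x ⟩
    0#                 ∎

  x-y≈0⇒x≈y : ∀ {x y} → x + -1# * y ≈ 0# → x ≈ y
  x-y≈0⇒x≈y {x} {y} h = begin
    x                    ≈⟨ +-identityʳ x ⟨
    x + 0#               ≈⟨ +-congˡ (cancel y) ⟨
    x + (y + -1# * y)    ≈⟨ solve 3 (λ x y z → x :+ (y :+ z) := x :+ z :+ y) refl x y (-1# * y) ⟩
    x + -1# * y + y      ≈⟨ +-congʳ h ⟩
    0# + y               ≈⟨ +-identityˡ y ⟩
    y                    ∎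

  -1*-1≈1 : -1# * -1# ≈ 1#
  -1*-1≈1 = begin
    -1# * -1#                 ≈⟨ +-identityʳ (-1# * -1#) ⟨
    -1# * -1# + 0#            ≈⟨ +-congˡ 1-1≈0 ⟨
    -1# * -1# + (1# + -1#)    ≈⟨ solve 3 (λ o m z → z :+ (o :+ m) := o :+ (m :+ z)) refl 1# -1# (-1# * -1#) ⟩
    1# + (-1# + -1# * -1#)    ≈⟨ +-congˡ (cancel -1#) ⟩
    1# + 0#                   ≈⟨ +-identityʳ 1# ⟩
    1#                        ∎

  neg-involutive : ∀ x → -1# * (-1# * x) ≈ x
  neg-involutive x = trans (sym (*-assoc -1# -1# x)) (trans (*-congʳ -1*-1≈1) (*-identityˡ x))

  -1≉0 : ¬ -1# ≈ 0#
  -1≉0 h = 1≉0 (trans (sym -1*-1≈1) (trans (*-congʳ h) (zeroˡ -1#)))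

  ι-1 : ι 1 ≈ 1#
  ι-1 = trans (ι-suc 0) (trans (+-congˡ ι-zero) (+-identityʳ 1#))

  ι-+ : ∀ j k → ι (j ℕ.+ k) ≈ ι j + ι k
  ι-+ zero    k = sym (trans (+-congʳ ι-zero) (+-identityˡ (ι k)))
  ι-+ (suc j) k = begin
    ι (suc (j ℕ.+ k))     ≈⟨ ι-suc (j ℕ.+ k) ⟩
    1# + ι (j ℕ.+ k)      ≈⟨ +-congˡ (ι-+ j k) ⟩
    1# + (ι j + ι k)      ≈⟨ +-assoc 1# (ι j) (ι k) ⟨
    1# + ι j + ι k        ≈⟨ +-congʳ (ι-suc j) ⟨
    ι (suc j) + ι k       ∎

  ι-suc≉0 : ∀ k → ¬ ι (suc k) ≈ 0#
  ι-suc≉0 k h = let y , ky≈1 , _ = reciprocal k in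
    1≉0 (trans (sym ky≈1) (trans (*-congʳ h) (zeroˡ y)))

  NonNeg-1 : NonNeg 1#
  NonNeg-1 = let y , 1y≈1 , 0≤y = reciprocal 0 in
    NonNeg-resp (trans (sym (*-identityˡ y)) (trans (*-congʳ (sym ι-1)) 1y≈1)) 0≤y

  NonNeg-ι : ∀ k → NonNeg (ι k)
  NonNeg-ι zero    = NonNeg-resp (sym ι-zero) NonNeg-0
  NonNeg-ι (suc k) = NonNeg-resp (sym (ι-suc k)) (NonNeg-+ NonNeg-1 (NonNeg-ι k))

  archimedean-uniform : ∀ {n} (a : Fin n → Carrier) → ∃ λ k → ∀ v → NonNeg (ι k + a v)
  archimedean-uniform {zero}  a = 0 , λ ()
  archimedean-uniform {suc n} a =
    let j , 0≤j+a = archimedean (a zero)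
        k , 0≤k+a = archimedean-uniform (a ∘ suc)
    in j ℕ.+ k , λ where
      zero → NonNeg-resp
        (trans (solve 3 (λ j k x → k :+ (j :+ x) := j :+ k :+ x) refl (ι j) (ι k) (a zero))
          (+-congʳ (sym (ι-+ j k))))
        (NonNeg-+ (NonNeg-ι k) 0≤j+a)
      (suc v) → NonNeg-resp
        (trans (sym (+-assoc (ι j) (ι k) (a (suc v)))) (+-congʳ (sym (ι-+ j k))))
        (NonNeg-+ (NonNeg-ι j) (0≤k+a v))

  infix 8 ⟨_,_⟩
  ⟨_,_⟩ : ∀ {n} → (Fin n → Carrier) → (Fin n → Carrier) → Carrier
  ⟨ a , f ⟩ = sum (λ v → a v * f v)

  comb : ∀ {n} → Carrier → (Fin n → Carrier) → Carrier → (Fin n → Carrier) → Fin n → Carrier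
  comb x a y b v = x * a v + y * b v

  ⟨⟩-comb : ∀ {n} x (a : Fin n → Carrier) y b f →
    ⟨ comb x a y b , f ⟩ ≈ x * ⟨ a , f ⟩ + y * ⟨ b , f ⟩
  ⟨⟩-comb x a y b f = begin
    sum (λ v → (x * a v + y * b v) * f v)
      ≈⟨ sum-cong-≋ (λ v → solve 5 (λ x a y b f → (x :* a :+ y :* b) :* f := x :* (a :* f) :+ y :* (b :* f))
           refl x (a v) y (b v) (f v)) ⟩
    sum (λ v → x * (a v * f v) + y * (b v * f v))
      ≈⟨ ∑-distrib-+ (λ v → x * (a v * f v)) (λ v → y * (b v * f v)) ⟩
    sum (λ v → x * (a v * f v)) + sum (λ v → y * (b v * f v))
      ≈⟨ +-cong (*-distribˡ-sum x (λ v → a v * f v)) (*-distribˡ-sum y (λ v → b v * f v)) ⟨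
    x * ⟨ a , f ⟩ + y * ⟨ b , f ⟩ ∎

  ⟨⟩-comm : ∀ {n} (a f : Fin n → Carrier) → ⟨ a , f ⟩ ≈ ⟨ f , a ⟩
  ⟨⟩-comm a f = sum-cong-≋ (λ v → *-comm (a v) (f v))

  ⟨⟩-combʳ : ∀ {n} x (f : Fin n → Carrier) y g a →
    ⟨ a , comb x f y g ⟩ ≈ x * ⟨ a , f ⟩ + y * ⟨ a , g ⟩
  ⟨⟩-combʳ x f y g a = trans (⟨⟩-comm a (comb x f y g)) (trans (⟨⟩-comb x f y g a)
    (+-cong (*-congˡ (⟨⟩-comm f a)) (*-congˡ (⟨⟩-comm g a))))

  ⟨0,_⟩ : ∀ {n} (f : Fin n → Carrier) → ⟨ (λ _ → 0#) , f ⟩ ≈ 0#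
  ⟨0,_⟩ {n} f = trans (sum-cong-≋ (λ v → zeroˡ (f v))) (sum-replicate-zero n)

  unit : ∀ {n} → Fin n → Fin n → Carrier
  unit zero    zero    = 1#
  unit zero    (suc _) = 0#
  unit (suc _) zero    = 0#
  unit (suc v) (suc w) = unit v w

  unit-same : ∀ {n} (v : Fin n) → unit v v ≈ 1#
  unit-same zero    = refl
  unit-same (suc v) = unit-same v

  unit-other : ∀ {n} {v w : Fin n} → v ≢ w → unit v w ≈ 0#
  unit-other {v = zero}  {zero}  v≢w = contradiction ≡.refl v≢w
  unit-other {v = zero}  {suc w} _   = refl
  unit-other {v = suc v} {zero}  _   = refl
  unit-other {v = suc v} {suc w} v≢w = unit-other (v≢w ∘ ≡.cong suc)

  ⟨unit⟩ : ∀ {n} (v : Fin n) f → ⟨ unit v , f ⟩ ≈ f v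
  ⟨unit⟩ zero f = begin
    1# * f zero + ⟨ (λ _ → 0#) , f ∘ suc ⟩   ≈⟨ +-cong (*-identityˡ (f zero)) ⟨0, f ∘ suc ⟩ ⟩
    f zero + 0#                              ≈⟨ +-identityʳ (f zero) ⟩
    f zero                                   ∎
  ⟨unit⟩ (suc v) f = begin
    0# * f zero + ⟨ unit v , f ∘ suc ⟩       ≈⟨ +-cong (zeroˡ (f zero)) (⟨unit⟩ v (f ∘ suc)) ⟩
    0# + f (suc v)                           ≈⟨ +-identityˡ (f (suc v)) ⟩
    f (suc v)                                ∎

  indicator : ∀ {n} → Subset n → Fin n → Carrier
  indicator (b ∷ _) zero    = if b then 1# else 0#
  indicator (_ ∷ s) (suc v) = indicator s v

  indicator-∈ : ∀ {n} {s : Subset n} {v} → v ∈ s → indicator s v ≈ 1#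
  indicator-∈ here        = refl
  indicator-∈ (there v∈s) = indicator-∈ v∈s

  indicator-∉ : ∀ {n} {s : Subset n} {v} → v ∉ s → indicator s v ≈ 0#
  indicator-∉ {s = inside ∷ s}  {zero}  v∉s = contradiction here v∉s
  indicator-∉ {s = outside ∷ s} {zero}  v∉s = refl
  indicator-∉ {s = _ ∷ s}       {suc v} v∉s = indicator-∉ (v∉s ∘ there)

  ⟨indicator,1⟩ : ∀ {n} (s : Subset n) f → (∀ v → f v ≈ 1#) → ⟨ indicator s , f ⟩ ≈ ι ∣ s ∣
  ⟨indicator,1⟩ []            f f≈1 = sym ι-zero
  ⟨indicator,1⟩ (inside ∷ s)  f f≈1 = trans
    (+-cong (trans (*-identityˡ (f zero)) (f≈1 zero)) (⟨indicator,1⟩ s (f ∘ suc) (f≈1 ∘ suc)))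
    (sym (ι-suc ∣ s ∣))
  ⟨indicator,1⟩ (outside ∷ s) f f≈1 = trans
    (+-cong (zeroˡ (f zero)) (⟨indicator,1⟩ s (f ∘ suc) (f≈1 ∘ suc)))
    (+-identityˡ (ι ∣ s ∣))

  Supported : ∀ {n} → Subset n → (Fin n → Carrier) → Set
  Supported s a = ∀ v → v ∉ s → a v ≈ 0#

  Supported-comb : ∀ {n} {s : Subset n} x {a} y {b} → Supported s a → Supported s b →
    Supported s (comb x a y b)
  Supported-comb x y a⊆s b⊆s v v∉s = trans
    (+-cong (trans (*-congˡ (a⊆s v v∉s)) (zeroʳ x)) (trans (*-congˡ (b⊆s v v∉s)) (zeroʳ y)))
    (+-identityˡ 0#)

  ⟨⟩-zeroʳ : ∀ {n} {s : Subset n} {a} f → Supported s a → (∀ v → v ∈ s → f v ≈ 0#) → ⟨ a , f ⟩ ≈ 0#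
  ⟨⟩-zeroʳ {n} {s} {a} f a⊆s f≈0 = trans (sum-cong-≋ term) (sum-replicate-zero n)
    where
    term : ∀ v → a v * f v ≈ 0#
    term v with v ∈? s
    ... | yes v∈s = trans (*-congˡ (f≈0 v v∈s)) (zeroʳ (a v))
    ... | no  v∉s = trans (*-congʳ (a⊆s v v∉s)) (zeroˡ (f v))

  -- Gaussian elimination; multiplying through by the pivot avoids inverting reals.
  nullVector : ∀ m {n} (A : Fin m → Fin n → Carrier) (s : Subset n) → m ℕ.< ∣ s ∣ →
    ¬ ¬ ∃ λ x → Supported s x × (∃ λ v → ¬ x v ≈ 0#) × (∀ j → ⟨ x , A j ⟩ ≈ 0#)
  nullVector zero A s 0<∣s∣ k =
    let v , v∈s = 0<∣s∣⇒nonempty s 0<∣s∣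
    in k (unit v , (λ w w∉s → unit-other {v = v} {w} λ { ≡.refl → w∉s v∈s }) ,
          (v , λ h → 1≉0 (trans (sym (unit-same v)) h)) , λ ())
  -- Which entries of the first row vanish may be taken as decided, since the goal is empty.
  nullVector (suc m) {n} A s m<∣s∣ k = ¬¬-∀-Fin (λ v → ¬¬-excluded-middle) step
    where
    step : ¬ (∀ v → Dec (A zero v ≈ 0#))
    step zero? with any? (λ v → v ∈? s ×-dec ¬? (zero? v))
    ... | no noPivot = nullVector m (A ∘ suc) s (ℕ.<-trans (ℕ.n<1+n m) m<∣s∣)
          λ (x , x⊆s , x≉0 , Ax≈0) → k (x , x⊆s , x≉0 , λ where
            zero    → ⟨⟩-zeroʳ (A zero) x⊆s A₀≈0
            (suc j) → Ax≈0 j)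
      where
      A₀≈0 : ∀ v → v ∈ s → A zero v ≈ 0#
      A₀≈0 v v∈s with zero? v
      ... | yes h = h
      ... | no ¬h = contradiction (v , v∈s , ¬h) noPivot
    -- `B` has the variable p eliminated from the remaining rows. A solution y of `B` is scaled by
    -- the pivot a and receives at p the coefficient that makes row zero vanish.
    ... | yes (p , p∈s , a≉0) = nullVector m B (s - p)
          (ℕ.≤-pred (ℕ.≤-trans m<∣s∣ (∣s∣≤1+∣s-x∣ s p))) λ (y , y⊆s-p , (v , yv≉0) , By≈0) →
            let σ = ⟨ y , A zero ⟩
                x = comb a y (-1# * σ) (unit p)
                v≢p : v ≢ p
                v≢p = λ { ≡.refl → yv≉0 (y⊆s-p p (x∉s-x s p)) }
            in k (x
              , (λ w w∉s → Supported-comb {s = s} a {y} (-1# * σ) {unit p}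
                  (λ w w∉s → y⊆s-p w (w∉s ∘ p─q⊆p s ⁅ p ⁆))
                  (λ w w∉s → unit-other {v = p} {w} λ { ≡.refl → w∉s p∈s }) w w∉s)
              , (v , λ xv≈0 → *-nonZero a≉0 yv≉0 (begin
                  a * y v                            ≈⟨ +-identityʳ (a * y v) ⟨
                  a * y v + 0#                       ≈⟨ +-congˡ (zeroʳ (-1# * σ)) ⟨
                  a * y v + -1# * σ * 0#             ≈⟨ +-congˡ (*-congˡ (unit-other (v≢p ∘ ≡.sym))) ⟨
                  x v                                ≈⟨ xv≈0 ⟩
                  0#                                 ∎))
              , λ where
                zero → begin
                  ⟨ x , A zero ⟩                     ≈⟨ expand y (A zero) ⟩
                  a * σ + -1# * σ * a                ≈⟨ +-congˡ (trans (*-assoc -1# σ a) (*-congˡ (*-comm σ a))) ⟩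
                  a * σ + -1# * (a * σ)              ≈⟨ cancel (a * σ) ⟩
                  0#                                 ∎
                (suc j) → begin
                  ⟨ x , A (suc j) ⟩                  ≈⟨ expand y (A (suc j)) ⟩
                  a * ⟨ y , A (suc j) ⟩ + -1# * σ * A (suc j) p
                    ≈⟨ +-congˡ (solve 3 (λ m s b → m :* s :* b := m :* b :* s) refl -1# σ (A (suc j) p)) ⟩
                  a * ⟨ y , A (suc j) ⟩ + -1# * A (suc j) p * σ
                    ≈⟨ ⟨⟩-combʳ a (A (suc j)) (-1# * A (suc j) p) (A zero) y ⟨
                  ⟨ y , B j ⟩                        ≈⟨ By≈0 j ⟩
                  0#                                 ∎)
      where
      a = A zero p
      B : Fin m → Fin n → Carrier
      B j = comb a (A (suc j)) (-1# * A (suc j) p) (A zero)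
      expand : ∀ y f → ⟨ comb a y (-1# * ⟨ y , A zero ⟩) (unit p) , f ⟩ ≈ a * ⟨ y , f ⟩ + -1# * ⟨ y , A zero ⟩ * f p
      expand y f = trans (⟨⟩-comb a y (-1# * ⟨ y , A zero ⟩) (unit p) f) (+-congˡ (*-congˡ (⟨unit⟩ p f)))

-- Charging edges to small faces

-- The Boolean is the sign, the second component the face τ. The map is total so as to be an
-- ordinary function; its values are constrained on edges only.
Charging : ∀ {n} → (Subset n → Set) → ℕ → Set
Charging {n} E k = ∃ λ (charge : Subset n → Bool × Subset n) →
  (∀ e → E e → proj₂ (charge e) ⊆ e × Nonempty (proj₂ (charge e)) × ∣ proj₂ (charge e) ∣ ℕ.≤ k) ×
  (∀ e e′ → E e → E e′ → charge e ≡ charge e′ → e ≡ e′)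

small-part : ∀ {d k} p q → d ℕ.≤ k ℕ.+ k → p ℕ.+ q ≡ suc d → p ℕ.≤ k ⊎ q ℕ.≤ k
small-part {d} {k} p q d≤2k eq with p ℕ.≤? k | q ℕ.≤? k
... | yes p≤k | _       = inj₁ p≤k
... | no  _   | yes q≤k = inj₂ q≤k
... | no p≰k  | no q≰k  = contradiction (begin-strict
      suc d           ≤⟨ ℕ.s≤s d≤2k ⟩
      suc k ℕ.+ k     <⟨ ℕ.+-monoʳ-< (suc k) (ℕ.≰⇒> q≰k) ⟩
      suc k ℕ.+ q     ≤⟨ ℕ.+-monoˡ-≤ q (ℕ.≰⇒> p≰k) ⟩
      p ℕ.+ q         ≡⟨ eq ⟩
      suc d           ∎) (ℕ.<-irrefl ≡.refl)
  where open ℕ.≤-Reasoning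

module Geometry (F : OrderedRing) where
  open OrderedRing F
  open LinearAlgebra F

  scale : ∀ {n} → Carrier → (Fin n → Carrier) → Fin n → Carrier
  scale x a v = x * a v

  ⟨⟩-scale : ∀ {n} x (a : Fin n → Carrier) f → ⟨ scale x a , f ⟩ ≈ x * ⟨ a , f ⟩
  ⟨⟩-scale x a f = trans (sum-cong-≋ (λ v → *-assoc x (a v) (f v))) (sym (*-distribˡ-sum x (λ v → a v * f v)))

  sg : Bool → Carrier
  sg true  = 1#
  sg false = -1#

  -sg : ∀ b → -1# * sg b ≈ sg (not b)
  -sg true  = *-identityʳ -1#
  -sg false = -1*-1≈1

  -- P j v is the j-th homogeneous coordinate of vertex v.
  module _ {n d} (P : Fin (suc d) → Fin n → Carrier) (P₀≈1 : ∀ v → P zero v ≈ 1#) (E : Subset n → Set) where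

    -- The points of the geometric realization: as `P zero` is constantly 1, the second condition
    -- says that the barycentric coordinates sum to 1.
    Point : (Fin n → Carrier) → Set
    Point α = (∀ v → NonNeg (α v)) × ⟨ α , P zero ⟩ ≈ 1# × ∃ λ e → E e × Supported e α

    module _ (injective : ∀ α β → Point α → Point β →
                (∀ j → ⟨ α , P j ⟩ ≈ ⟨ β , P j ⟩) → ∀ v → α v ≈ β v) where

      -- Move from the barycenter of τ by a small multiple of a, respectively a′.
      agree : ∀ {e e′ τ} a a′ → E e → E e′ → Nonempty τ → τ ⊆ e → τ ⊆ e′ →
        Supported e a → Supported e′ a′ → ⟨ a , P zero ⟩ ≈ 0# → ⟨ a′ , P zero ⟩ ≈ 0# →
        (∀ v → v ∉ τ → NonNeg (a v)) → (∀ v → v ∉ τ → NonNeg (a′ v)) →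
        (∀ j → ⟨ a , P j ⟩ ≈ ⟨ a′ , P j ⟩) → ∀ v → a v ≈ a′ v
      agree {e} {e′} {τ} a a′ Ee Ee′ (t , t∈τ) τ⊆e τ⊆e′ a⊆e a′⊆e′ Σa≈0 Σa′≈0 0≤a 0≤a′ Pa≈Pa′ v =
        begin
          a v                                 ≈⟨ unscale (a v) ⟨
          ι M * ι ∣ τ ∣ * (η * a v)           ≈⟨ *-congˡ (x-y≈0⇒x≈y difference) ⟩
          ι M * ι ∣ τ ∣ * (η * a′ v)          ≈⟨ unscale (a′ v) ⟩
          a′ v                                ∎
        where
        N = proj₁ (archimedean-uniform a)
        N′ = proj₁ (archimedean-uniform a′)
        -- The sum makes M + a and M + a′ nonnegative everywhere; the successor makes M invertible.
        M = suc (N ℕ.+ N′)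
        1/M = proj₁ (reciprocal (N ℕ.+ N′))
        M/M = proj₁ (proj₂ (reciprocal (N ℕ.+ N′)))
        τ-suc : ∃ λ k → ∣ τ ∣ ≡ suc k
        τ-suc = ℕ.pred ∣ τ ∣ , ≡.sym (ℕ.suc-pred ∣ τ ∣ {{ℕ.>-nonZero (ℕ.≤-<-trans ℕ.z≤n (x∈p⇒∣p-x∣<∣p∣ t∈τ))}})
        1/τ = proj₁ (reciprocal (proj₁ τ-suc))
        τ/τ : ι ∣ τ ∣ * 1/τ ≈ 1#
        τ/τ = trans (*-congʳ (reflexive (≡.cong ι (proj₂ τ-suc)))) (proj₁ (proj₂ (reciprocal (proj₁ τ-suc))))
        -- The step size. The product η M is 1 / ∣τ∣, the weight of each vertex of τ in the
        -- barycenter.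
        η = 1/M * 1/τ
        0≤η : NonNeg η
        0≤η = NonNeg-* (proj₂ (proj₂ (reciprocal (N ℕ.+ N′)))) (proj₂ (proj₂ (reciprocal (proj₁ τ-suc))))
        ηMτ≈1 : ι M * ι ∣ τ ∣ * η ≈ 1#
        ηMτ≈1 = begin
          ι M * ι ∣ τ ∣ * (1/M * 1/τ)    ≈⟨ solve 4 (λ a b c d → a :* b :* (c :* d) := a :* c :* (b :* d)) refl
                                              (ι M) (ι ∣ τ ∣) 1/M 1/τ ⟩
          ι M * 1/M * (ι ∣ τ ∣ * 1/τ)    ≈⟨ *-cong M/M τ/τ ⟩
          1# * 1#                        ≈⟨ *-identityˡ 1# ⟩
          1#                             ∎
        unscale : ∀ x → ι M * ι ∣ τ ∣ * (η * x) ≈ x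
        unscale x = trans (sym (*-assoc (ι M * ι ∣ τ ∣) η x)) (trans (*-congʳ ηMτ≈1) (*-identityˡ x))
        α : (Fin n → Carrier) → Fin n → Carrier
        α = comb (η * ι M) (indicator τ) η
        0≤M+a : ∀ v → NonNeg (ι M + a v)
        0≤M+a v = NonNeg-resp
          (trans (solve 4 (λ o x y z → o :+ y :+ (x :+ z) := o :+ (x :+ y) :+ z) refl 1# (ι N) (ι N′) (a v))
            (+-congʳ (trans (+-congˡ (sym (ι-+ N N′))) (sym (ι-suc (N ℕ.+ N′))))))
          (NonNeg-+ (NonNeg-+ NonNeg-1 (NonNeg-ι N′)) (proj₂ (archimedean-uniform a) v))
        0≤M+a′ : ∀ v → NonNeg (ι M + a′ v)
        0≤M+a′ v = NonNeg-resp
          (trans (solve 4 (λ o x y z → o :+ x :+ (y :+ z) := o :+ (x :+ y) :+ z) refl 1# (ι N) (ι N′) (a′ v))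
            (+-congʳ (trans (+-congˡ (sym (ι-+ N N′))) (sym (ι-suc (N ℕ.+ N′))))))
          (NonNeg-+ (NonNeg-+ NonNeg-1 (NonNeg-ι N)) (proj₂ (archimedean-uniform a′) v))
        α-point : ∀ {f} b → E f → τ ⊆ f → Supported f b → ⟨ b , P zero ⟩ ≈ 0# →
          (∀ v → v ∉ τ → NonNeg (b v)) → (∀ v → NonNeg (ι M + b v)) → Point (α b)
        α-point {f} b Ef τ⊆f b⊆f Σb≈0 0≤b 0≤M+b = nonNeg , total , f , Ef ,
            Supported-comb {s = f} (η * ι M) {indicator τ} η {b} (λ w w∉f → indicator-∉ (w∉f ∘ τ⊆f)) b⊆f
          where
          nonNeg : ∀ w → NonNeg (α b w)
          -- On τ the coordinate is η (M + b w), elsewhere it is η (b w).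
          nonNeg w with w ∈? τ
          ... | yes w∈τ = NonNeg-resp
                  (trans (distribˡ η (ι M) (b w))
                    (+-congʳ (trans (sym (*-identityʳ (η * ι M))) (*-congˡ (sym (indicator-∈ w∈τ))))))
                  (NonNeg-* 0≤η (0≤M+b w))
          ... | no w∉τ = NonNeg-resp
                  (trans (sym (+-identityˡ (η * b w)))
                    (+-congʳ (trans (sym (zeroʳ (η * ι M))) (*-congˡ (sym (indicator-∉ w∉τ))))))
                  (NonNeg-* 0≤η (0≤b w w∉τ))
          total : ⟨ α b , P zero ⟩ ≈ 1#
          total = begin
            ⟨ α b , P zero ⟩
              ≈⟨ ⟨⟩-comb (η * ι M) (indicator τ) η b (P zero) ⟩
            η * ι M * ⟨ indicator τ , P zero ⟩ + η * ⟨ b , P zero ⟩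
              ≈⟨ +-cong (*-congˡ (⟨indicator,1⟩ τ (P zero) P₀≈1)) (trans (*-congˡ Σb≈0) (zeroʳ η)) ⟩
            η * ι M * ι ∣ τ ∣ + 0#
              ≈⟨ +-identityʳ _ ⟩
            η * ι M * ι ∣ τ ∣
              ≈⟨ solve 3 (λ h m t → h :* m :* t := m :* t :* h) refl η (ι M) (ι ∣ τ ∣) ⟩
            ι M * ι ∣ τ ∣ * η
              ≈⟨ ηMτ≈1 ⟩
            1# ∎
        αa≈αa′ : α a v ≈ α a′ v
        αa≈αa′ = injective (α a) (α a′)
          (α-point a Ee τ⊆e a⊆e Σa≈0 0≤a 0≤M+a) (α-point a′ Ee′ τ⊆e′ a′⊆e′ Σa′≈0 0≤a′ 0≤M+a′)
          (λ j → trans (⟨⟩-comb (η * ι M) (indicator τ) η a (P j))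
            (trans (+-congˡ (*-congˡ (Pa≈Pa′ j)))
              (sym (⟨⟩-comb (η * ι M) (indicator τ) η a′ (P j)))))
          v
        difference : η * a v + -1# * (η * a′ v) ≈ 0#
        difference = begin
          η * a v + -1# * (η * a′ v)
            ≈⟨ +-identityˡ _ ⟨
          0# + (η * a v + -1# * (η * a′ v))
            ≈⟨ +-congʳ (cancel z) ⟨
          z + -1# * z + (η * a v + -1# * (η * a′ v))
            ≈⟨ solve 4 (λ z x y m → z :+ m :* z :+ (x :+ m :* y) := (z :+ x) :+ m :* (z :+ y)) refl
                 z (η * a v) (η * a′ v) -1# ⟩
          α a v + -1# * α a′ v
            ≈⟨ +-congʳ αa≈αa′ ⟩
          α a′ v + -1# * α a′ v
            ≈⟨ cancel _ ⟩
          0# ∎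
          where z = η * ι M * indicator τ v

      module _ (uniform : ∀ e → E e → ∣ e ∣ ≡ suc d) where

        edge-nonempty : ∀ e → E e → Nonempty e
        edge-nonempty e Ee = 0<∣s∣⇒nonempty e (≡.subst (0 ℕ.<_) (≡.sym (uniform e Ee)) (ℕ.s≤s ℕ.z≤n))

        -- In `agree` take τ = e: from the barycenter of e a small step in any direction stays in
        -- the simplex, so a can be compared with the zero direction.
        affinely-independent : ∀ {e} a → E e → Supported e a → (∀ j → ⟨ a , P j ⟩ ≈ 0#) → ∀ v → a v ≈ 0#
        affinely-independent {e} a Ee a⊆e Pa≈0 = agree a (λ _ → 0#) Ee Ee (edge-nonempty e Ee) (λ h → h) (λ h → h)
          a⊆e (λ _ _ → refl) (Pa≈0 zero) ⟨0, P zero ⟩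
          (λ v v∉e → NonNeg-resp (sym (a⊆e v v∉e)) NonNeg-0) (λ _ _ → NonNeg-0)
          (λ j → trans (Pa≈0 j) (sym ⟨0, P j ⟩))

        -- u lies in the span of a facet of e, namely of the one opposite i.
        Degenerate : Subset n → Fin n → (Fin (suc d) → Carrier) → Set
        Degenerate e i u = E e × i ∈ e × ∃ λ κ → ∃ λ a →
          ¬ κ ≈ 0# × Supported e a × a i ≈ 0# × (∀ j → ⟨ a , P j ⟩ ≈ κ * u j)

        -- Generic directions

        Avoids : (Fin (suc d) → Carrier) → Subset n × Fin n → Set
        Avoids u (e , i) = ¬ Degenerate e i u

        AvoidsOne : (u w : Fin (suc d) → Carrier) → Subset n × Fin n → Set
        AvoidsOne u w (e , i) = ¬ (Degenerate e i u × Degenerate e i w)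

        shift : (u w : Fin (suc d) → Carrier) → ℕ → Fin (suc d) → Carrier
        shift u w s j = u j + ι s * w j

        -- A line with two points in a subspace lies in it. For the points u + s w and u + (s + δ)
        -- w, taking s + δ times the first minus s times the second gives δ u, and the second minus
        -- the first gives δ w; the multipliers κ and κ′ are carried along.
        two-degenerate : ∀ {e i} u w s l →
          Degenerate e i (shift u w s) → Degenerate e i (shift u w (s ℕ.+ suc l)) →
          Degenerate e i u × Degenerate e i w
        two-degenerate {e} {i} u w s l
          (Ee , i∈e , κ , a , κ≉0 , a⊆e , ai≈0 , Pa≈) (_ , _ , κ′ , a′ , κ′≉0 , a′⊆e , a′i≈0 , Pa′≈) =
          (Ee , i∈e , κ * κ′ * δ , comb (κ′ * (ι s + δ)) a (-1# * (κ * ι s)) a′ , κκ′δ≉0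
            , Supported-comb {s = e} (κ′ * (ι s + δ)) {a} (-1# * (κ * ι s)) {a′} a⊆e a′⊆e
            , vanish (κ′ * (ι s + δ)) (-1# * (κ * ι s)) {a} {a′} ai≈0 a′i≈0
            , λ j → trans (⟨⟩-comb (κ′ * (ι s + δ)) a (-1# * (κ * ι s)) a′ (P j))
                (trans (+-cong (*-congˡ (Pa≈ j)) (*-congˡ (Pa′≈′ j)))
                (trans (solve 7 (λ k k′ t d u w m →
                    k′ :* (t :+ d) :* (k :* (u :+ t :* w)) :+ m :* (k :* t) :* (k′ :* (u :+ (t :+ d) :* w)) :=
                    k :* k′ :* d :* u :+
                      (k :* k′ :* t :* (u :+ (t :+ d) :* w) :+ m :* (k :* k′ :* t :* (u :+ (t :+ d) :* w))))
                    refl κ κ′ (ι s) δ (u j) (w j) -1#)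
                  (trans (+-congˡ (cancel _)) (+-identityʳ _))))) ,
          (Ee , i∈e , κ * κ′ * δ , comb κ a′ (-1# * κ′) a , κκ′δ≉0
            , Supported-comb {s = e} κ {a′} (-1# * κ′) {a} a′⊆e a⊆e
            , vanish κ (-1# * κ′) {a′} {a} a′i≈0 ai≈0
            , λ j → trans (⟨⟩-comb κ a′ (-1# * κ′) a (P j))
                (trans (+-cong (*-congˡ (Pa′≈′ j)) (*-congˡ (Pa≈ j)))
                (trans (solve 7 (λ k k′ t d u w m →
                    k :* (k′ :* (u :+ (t :+ d) :* w)) :+ m :* k′ :* (k :* (u :+ t :* w)) :=
                    k :* k′ :* d :* w :+ (k :* k′ :* (u :+ t :* w) :+ m :* (k :* k′ :* (u :+ t :* w))))
                    refl κ κ′ (ι s) δ (u j) (w j) -1#)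
                  (trans (+-congˡ (cancel _)) (+-identityʳ _)))))
          where
          δ = ι (suc l)
          κκ′δ≉0 : ¬ κ * κ′ * δ ≈ 0#
          κκ′δ≉0 = *-nonZero (*-nonZero κ≉0 κ′≉0) (ι-suc≉0 l)
          Pa′≈′ : ∀ j → ⟨ a′ , P j ⟩ ≈ κ′ * (u j + (ι s + δ) * w j)
          Pa′≈′ j = trans (Pa′≈ j) (*-congˡ (+-congˡ (*-congʳ (ι-+ s (suc l)))))
          vanish : ∀ x y {b b′} → b i ≈ 0# → b′ i ≈ 0# → comb x b y b′ i ≈ 0#
          vanish x y bi≈0 b′i≈0 = trans
            (+-cong (trans (*-congˡ bi≈0) (zeroʳ x)) (trans (*-congˡ b′i≈0) (zeroʳ y))) (+-identityˡ 0#)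

        -- At most one s is degenerate. A threshold, rather than that s itself, is what can be
        -- combined over several pairs (e , i) by a maximum.
        eventually-nondegenerate : ∀ {e i} u w → ¬ (Degenerate e i u × Degenerate e i w) →
          ¬ ¬ ∃ λ s₀ → ∀ s → s₀ ℕ.≤ s → ¬ Degenerate e i (shift u w s)
        eventually-nondegenerate {e} {i} u w ¬both k = ¬¬-excluded-middle λ where
          (no none) → k (0 , λ s _ D → none (s , D))
          (yes (s , D)) → k (suc s , λ s′ s<s′ D′ → ¬both (two-degenerate u w s (s′ ℕ.∸ suc s) D
            (≡.subst (Degenerate e i ∘ shift u w)
              (≡.sym (≡.trans (ℕ.+-suc s (s′ ℕ.∸ suc s)) (ℕ.m+[n∸m]≡n s<s′))) D′)))

        eventually-all-nondegenerate : ∀ u w L → All (AvoidsOne u w) L →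
          ¬ ¬ ∃ λ s₀ → ∀ s → s₀ ℕ.≤ s → All (Avoids (shift u w s)) L
        eventually-all-nondegenerate u w []      []       k = k (0 , λ _ _ → [])
        eventually-all-nondegenerate u w (_ ∷ L) (h ∷ hs) k =
          eventually-nondegenerate u w h λ (s , p) → eventually-all-nondegenerate u w L hs λ (t , q) →
          k (s ℕ.⊔ t , λ r ≤r → p r (ℕ.m⊔n≤o⇒m≤o s t ≤r) ∷ q r (ℕ.m⊔n≤o⇒n≤o s t ≤r))

        module _ (1≤d : 1 ℕ.≤ d) where

          other-vertex : ∀ e i → E e → ∃ λ l → l ∈ e × l ≢ i
          other-vertex e i Ee =
            let l , l∈ = 0<∣s∣⇒nonempty (e - i) (ℕ.≤-trans 1≤d (ℕ.≤-pred
                           (≡.subst (ℕ._≤ suc ∣ e - i ∣) (uniform e Ee) (∣s∣≤1+∣s-x∣ e i))))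
            in l , p─q⊆p e ⁅ i ⁆ l∈ , λ l≡i → x∉s-x e i (≡.subst (_∈ e - i) l≡i l∈)

          -- The direction is that from another vertex l of e to i. Were it in the span of the facet
          -- opposite i, subtraction would yield an affine dependence on e with the nonzero
          -- coefficient -κ at i.
          edge-direction : ∀ e i → E e → i ∈ e →
            ∃ λ w → w zero ≈ 0# × ¬ Degenerate e i w
          edge-direction e i Ee i∈e =
            let l , l∈e , l≢i = other-vertex e i Ee
                w = λ j → P j i + -1# * P j l
            in w , trans (+-cong (P₀≈1 i) (trans (*-congˡ (P₀≈1 l)) (*-identityʳ -1#))) 1-1≈0
             , λ (_ , _ , κ , a , κ≉0 , a⊆e , ai≈0 , Pa≈κw) →
               let f = comb 1# (unit i) -1# (unit l)
                   b = comb 1# a (-1# * κ) f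
                   f⊆e = Supported-comb {s = e} 1# {unit i} -1# {unit l}
                     (λ v v∉e → unit-other {v = i} {v} λ { ≡.refl → v∉e i∈e })
                     (λ v v∉e → unit-other {v = l} {v} λ { ≡.refl → v∉e l∈e })
                   Pb≈0 = λ j → begin
                     ⟨ b , P j ⟩
                       ≈⟨ ⟨⟩-comb 1# a (-1# * κ) f (P j) ⟩
                     1# * ⟨ a , P j ⟩ + -1# * κ * ⟨ f , P j ⟩
                       ≈⟨ +-cong (trans (*-identityˡ _) (Pa≈κw j)) (*-congˡ
                            (trans (⟨⟩-comb 1# (unit i) -1# (unit l) (P j))
                            (+-cong (trans (*-identityˡ _) (⟨unit⟩ i (P j))) (*-congˡ (⟨unit⟩ l (P j)))))) ⟩
                     κ * w j + -1# * κ * w j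
                       ≈⟨ +-congˡ (*-assoc -1# κ (w j)) ⟩
                     κ * w j + -1# * (κ * w j)
                       ≈⟨ cancel (κ * w j) ⟩
                     0# ∎
                   bi≈-κ = begin
                     1# * a i + -1# * κ * (1# * unit i i + -1# * unit l i)
                       ≈⟨ +-cong (trans (*-congˡ ai≈0) (zeroʳ 1#)) (*-congˡ (+-cong
                            (trans (*-identityˡ _) (unit-same i))
                            (trans (*-congˡ (unit-other l≢i)) (zeroʳ -1#)))) ⟩
                     0# + -1# * κ * (1# + 0#)
                       ≈⟨ trans (+-identityˡ _) (trans (*-congˡ (+-identityʳ 1#)) (*-identityʳ _)) ⟩
                     -1# * κ ∎
               in *-nonZero -1≉0 κ≉0 (trans (sym bi≈-κ)
                    (affinely-independent b Ee (Supported-comb {s = e} 1# {a} (-1# * κ) {f} a⊆e f⊆e) Pb≈0 i))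

          -- Induction over the facets: u avoids those already treated and w the new one, so u + s w
          -- avoids all of them for large s.
          generic-direction-list : ∀ L → ¬ ¬ ∃ λ u → u zero ≈ 0# × All (Avoids u) L
          generic-direction-list []            k = k ((λ _ → 0#) , refl , [])
          generic-direction-list ((e , i) ∷ L) k = generic-direction-list L λ (u , u₀≈0 , nd) →
            ¬¬-excluded-middle λ where
              (no ¬e,i) → k (u , u₀≈0 , (λ (Ee , i∈e , _) → ¬e,i (Ee , i∈e)) ∷ nd)
              (yes (Ee , i∈e)) →
                let w , w₀≈0 , ¬D = edge-direction e i Ee i∈e
                in eventually-all-nondegenerate u w ((e , i) ∷ L)
                  ((λ (_ , D) → ¬D D) ∷ All.map {P = Avoids u} {Q = AvoidsOne u w} (λ ¬Du (Du , _) → ¬Du Du) nd)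
                  λ (s , nd′) →
                  k (shift u w s ,
                    trans (+-cong u₀≈0 (trans (*-congˡ w₀≈0) (zeroʳ (ι s)))) (+-identityˡ 0#) ,
                    nd′ s ℕ.≤-refl)

          generic-direction : ¬ ¬ ∃ λ u → u zero ≈ 0# × ∀ e i → ¬ Degenerate e i u
          generic-direction k = generic-direction-list (cartesianProduct (subsets n) (allFin n)) λ (u , u₀≈0 , nd) →
            k (u , u₀≈0 , λ e i → All.lookup {P = Avoids u} nd (∈-cartesianProduct⁺ (∈-subsets e) (∈-allFin i)))

          -- Expresses that u, taken with the sign b, leads from the barycenter of τ into the
          -- interior of e: coefficients may be negative on τ only, and none vanishes on e.
          Charged : (Fin (suc d) → Carrier) → Subset n → Bool → Subset n → Set
          Charged u e b τ = ∃ λ κ → ∃ λ a → NonNeg κ × ¬ κ ≈ 0# × Supported e a ×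
            (∀ v → v ∉ τ → NonNeg (a v)) × (∀ v → v ∈ e → ¬ a v ≈ 0#) ×
            (∀ j → ⟨ a , P j ⟩ ≈ κ * (sg b * u j))

          -- Multiplied by κ′ and κ, the two coefficient vectors represent the same direction, so
          -- `agree` identifies them. Their supports are exactly e and e′.
          charged-⊆ : ∀ (u : Fin (suc d) → Carrier) {e e′} b {τ} → u zero ≈ 0# →
            E e → E e′ → Nonempty τ → τ ⊆ e → τ ⊆ e′ →
            Charged u e b τ → Charged u e′ b τ → e ⊆ e′
          charged-⊆ u {e} {e′} b {τ} u₀≈0 Ee Ee′ τ≠∅ τ⊆e τ⊆e′
            (κ , a , 0≤κ , κ≉0 , a⊆e , 0≤a , a≉0 , Pa) (κ′ , a′ , 0≤κ′ , κ′≉0 , a′⊆e′ , 0≤a′ , a′≉0 , Pa′) {v} v∈e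
            with v ∈? e′
          ... | yes v∈e′ = v∈e′
          ... | no  v∉e′ = contradiction
                (trans (agree (scale κ′ a) (scale κ a′) Ee Ee′ τ≠∅ τ⊆e τ⊆e′
                    (λ w w∉ → trans (*-congˡ (a⊆e w w∉)) (zeroʳ κ′))
                    (λ w w∉ → trans (*-congˡ (a′⊆e′ w w∉)) (zeroʳ κ))
                    (total κ′ κ a Pa) (total κ κ′ a′ Pa′)
                    (λ w w∉ → NonNeg-* 0≤κ′ (0≤a w w∉))
                    (λ w w∉ → NonNeg-* 0≤κ (0≤a′ w w∉))
                    (λ j → trans (trans (⟨⟩-scale κ′ a (P j)) (*-congˡ (Pa j)))
                      (trans (solve 3 (λ k k′ x → k′ :* (k :* x) := k :* (k′ :* x)) refl κ κ′ (sg b * u j))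
                        (sym (trans (⟨⟩-scale κ a′ (P j)) (*-congˡ (Pa′ j)))))) v)
                  (trans (*-congˡ (a′⊆e′ v v∉e′)) (zeroʳ κ)))
                (*-nonZero κ′≉0 (a≉0 v v∈e))
            where
            total : ∀ x y c → (∀ j → ⟨ c , P j ⟩ ≈ y * (sg b * u j)) → ⟨ scale x c , P zero ⟩ ≈ 0#
            total x y c Pc = trans (⟨⟩-scale x c (P zero)) (trans (*-congˡ (trans (Pc zero)
              (trans (*-congˡ (trans (*-congˡ u₀≈0) (zeroʳ (sg b)))) (zeroʳ y)))) (zeroʳ x))

          -- There are d + 1 equations in d + 2 unknowns, namely the coefficient of u (index zero of
          -- `inside ∷ e`) and those of the vertices of e. In a nontrivial solution the former is
          -- nonzero by affine independence.
          represent : ∀ (u : Fin (suc d) → Carrier) e → E e →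
            ¬ ¬ ∃ λ κ → ∃ λ a → ¬ κ ≈ 0# × Supported e a × (∀ j → ⟨ a , P j ⟩ ≈ κ * u j)
          represent u e Ee k = nullVector (suc d) A (inside ∷ e) (ℕ.s≤s (ℕ.≤-reflexive (≡.sym (uniform e Ee))))
            λ (x , x⊆ , (v , xv≉0) , Ax≈0) →
              let a⊆e = λ w w∉e → x⊆ (suc w) λ { (there w∈e) → w∉e w∈e }
                  Pa = λ j → x-y≈0⇒x≈y (begin
                    ⟨ x ∘ suc , P j ⟩ + -1# * (x zero * u j)
                      ≈⟨ solve 4 (λ p x u m → p :+ m :* (x :* u) := x :* (m :* u) :+ p) refl
                           ⟨ x ∘ suc , P j ⟩ (x zero) (u j) -1# ⟩
                    x zero * (-1# * u j) + ⟨ x ∘ suc , P j ⟩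
                      ≈⟨ Ax≈0 j ⟩
                    0# ∎)
              in k (x zero , x ∘ suc ,
                (λ x₀≈0 → xv≉0 (vanish x a⊆e Pa x₀≈0 v)) , a⊆e , Pa)
            where
            A : Fin (suc d) → Fin (suc n) → Carrier
            A j zero    = -1# * u j
            A j (suc v) = P j v
            vanish : ∀ x → Supported e (x ∘ suc) → (∀ j → ⟨ x ∘ suc , P j ⟩ ≈ x zero * u j) →
              x zero ≈ 0# → ∀ v → x v ≈ 0#
            vanish x a⊆e Pa x₀≈0 zero    = x₀≈0
            vanish x a⊆e Pa x₀≈0 (suc v) = affinely-independent (x ∘ suc) Ee a⊆e
              (λ j → trans (Pa j) (trans (*-congʳ x₀≈0) (zeroˡ (u j)))) v

          represent-signed : ∀ (u : Fin (suc d) → Carrier) e → E e → (∀ i → ¬ Degenerate e i u) →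
            ¬ ¬ ∃ λ b → ∃ λ κ → ∃ λ a → NonNeg κ × ¬ κ ≈ 0# × Supported e a ×
              (∀ v → v ∈ e → ¬ a v ≈ 0#) × (∀ j → ⟨ a , P j ⟩ ≈ κ * (sg b * u j))
          represent-signed u e Ee nd k = represent u e Ee λ (κ , a , κ≉0 , a⊆e , Pa) →
            let a≉0 = λ v v∈e av≈0 → nd v (Ee , v∈e , κ , a , κ≉0 , a⊆e , av≈0 , Pa)
            in sign κ λ where
              (inj₁ 0≤κ) → k (true , κ , a , 0≤κ , κ≉0 , a⊆e , a≉0 ,
                λ j → trans (Pa j) (*-congˡ (sym (*-identityˡ (u j)))))
              (inj₂ 0≤-κ) → k (false , -1# * κ , a , 0≤-κ , *-nonZero -1≉0 κ≉0 , a⊆e , a≉0 ,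
                λ j → trans (Pa j) (trans (sym (neg-involutive _))
                  (solve 3 (λ m k u → m :* (m :* (k :* u)) := m :* k :* (m :* u)) refl -1# κ (u j))))

          module _ {k} (1≤k : 1 ℕ.≤ k) (d≤2k : d ℕ.≤ k ℕ.+ k) where

            ChargeOf : (Fin (suc d) → Carrier) → Subset n → Bool → Subset n → Set
            ChargeOf u e b τ = τ ⊆ e × Nonempty τ × ∣ τ ∣ ℕ.≤ k × Charged u e b τ

            -- An empty τ has no barycenter. In that case no coefficient is negative, so any single
            -- vertex of e can take its place.
            enlarge : ∀ u {e} b τ → E e → τ ⊆ e → ∣ τ ∣ ℕ.≤ k → Charged u e b τ → ∃ (ChargeOf u e b)
            enlarge u {e} b τ Ee τ⊆e ∣τ∣≤k charged@(κ , a , 0≤κ , κ≉0 , a⊆e , 0≤a , a≉0 , Pa) with nonempty? τ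
            ... | yes τ≠∅ = τ , τ⊆e , τ≠∅ , ∣τ∣≤k , charged
            ... | no  τ=∅ = let v , v∈e = edge-nonempty e Ee in
                  ⁅ v ⁆ , (λ w∈ → ≡.subst (_∈ e) (≡.sym (x∈⁅y⁆⇒x≡y v w∈)) v∈e) , (v , x∈⁅x⁆ v) ,
                  ≡.subst (ℕ._≤ k) (≡.sym (∣⁅x⁆∣≡1 v)) 1≤k ,
                  κ , a , 0≤κ , κ≉0 , a⊆e , (λ w _ → 0≤a w λ w∈τ → τ=∅ (w , w∈τ)) , a≉0 , Pa

            charge-edge : ∀ (u : Fin (suc d) → Carrier) e → E e → (∀ i → ¬ Degenerate e i u) →
              ¬ ¬ ∃ λ b → ∃ (ChargeOf u e b)
            charge-edge u e Ee nd c = represent-signed u e Ee nd λ (b , κ , a , 0≤κ , κ≉0 , a⊆e , a≉0 , Pa) →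
              -- `swap` puts nonpositive coefficients into S and nonnegative ones outside. If the
              -- part of e outside S is the small one, a and the sign b are both reversed.
              ¬¬-separate (λ v s → sign (a v) (s ∘ swap)) λ (S , S-neg , S-pos) →
              [ (λ small → c (b , enlarge u b (e ∩ S) Ee (p∩q⊆p e S) small
                    (κ , a , 0≤κ , κ≉0 , a⊆e , positive {a} a⊆e S-pos , a≉0 , Pa)))
              , (λ small → c (not b , enlarge u (not b) (e ∩ ∁ S) Ee (p∩q⊆p e (∁ S)) small
                    (κ , scale -1# a , 0≤κ , κ≉0 , (λ v v∉e → trans (*-congˡ (a⊆e v v∉e)) (zeroʳ -1#))
                    , negative {a} a⊆e S-neg , (λ v v∈e → *-nonZero -1≉0 (a≉0 v v∈e))
                    , λ j → trans (⟨⟩-scale -1# a (P j)) (trans (*-congˡ (Pa j))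
                        (trans (solve 4 (λ m k s u → m :* (k :* (s :* u)) := k :* (m :* s :* u)) refl
                              -1# κ (sg b) (u j))
                          (*-congˡ (*-congʳ (-sg b))))))))
              ]′ (small-part ∣ e ∩ S ∣ ∣ e ∩ ∁ S ∣ d≤2k (≡.trans (∣p∩q∣+∣p∩∁q∣≡∣p∣ e S) (uniform e Ee)))
              where
              positive : ∀ {a S} → Supported e a → (∀ v → v ∉ S → NonNeg (a v)) → ∀ v → v ∉ e ∩ S → NonNeg (a v)
              positive {a} {S} a⊆e S-pos v v∉ with v ∈? e
              ... | yes v∈e = S-pos v λ v∈S → v∉ (x∈p∩q⁺ (v∈e , v∈S))
              ... | no  v∉e = NonNeg-resp (sym (a⊆e v v∉e)) NonNeg-0
              negative : ∀ {a S} → Supported e a → (∀ v → v ∈ S → NonNeg (-1# * a v)) →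
                ∀ v → v ∉ e ∩ ∁ S → NonNeg (-1# * a v)
              negative {a} {S} a⊆e S-neg v v∉ with v ∈? e
              ... | yes v∈e = S-neg v (x∉∁p⇒x∈p λ v∈∁S → v∉ (x∈p∩q⁺ (v∈e , v∈∁S)))
              ... | no  v∉e = NonNeg-resp (sym (trans (*-congˡ (a⊆e v v∉e)) (zeroʳ -1#))) NonNeg-0

            charging : ¬ ¬ Charging E k
            charging c = generic-direction λ (u , u₀≈0 , nd) →
              ¬¬-∀-Subset (choose u nd) λ choice → c
                ( (λ e → proj₁ (choice e) , proj₁ (proj₂ (choice e)))
                , (λ e Ee → let τ⊆e , τ≠∅ , small , _ = proj₂ (proj₂ (choice e)) Ee in τ⊆e , τ≠∅ , small)
                , λ e e′ Ee Ee′ eq → inj u u₀≈0 Ee Ee′ (≡.cong proj₁ eq) (≡.cong proj₂ eq)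
                    (proj₂ (proj₂ (choice e)) Ee) (proj₂ (proj₂ (choice e′)) Ee′))
              where
              choose : ∀ (u : Fin (suc d) → Carrier) → (∀ e i → ¬ Degenerate e i u) → ∀ e →
                ¬ ¬ ∃ λ b → ∃ λ τ → E e → ChargeOf u e b τ
              choose u nd e h = ¬¬-excluded-middle λ where
                (yes Ee) → charge-edge u e Ee (nd e) λ (b , τ , p) → h (b , τ , λ _ → p)
                -- An arbitrary value for sets that are not edges.
                (no ¬Ee) → h (true , e , λ Ee → contradiction Ee ¬Ee)
              inj : ∀ u {e e′ b b′ τ τ′} → u zero ≈ 0# → E e → E e′ → b ≡ b′ → τ ≡ τ′ →
                ChargeOf u e b τ → ChargeOf u e′ b′ τ′ → e ≡ e′
              inj u {b = b} u₀≈0 Ee Ee′ ≡.refl ≡.refl (τ⊆e , τ≠∅ , _ , ch) (τ⊆e′ , _ , _ , ch′) = ⊆-antisym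
                (charged-⊆ u b u₀≈0 Ee Ee′ τ≠∅ τ⊆e τ⊆e′ ch ch′) (charged-⊆ u b u₀≈0 Ee′ Ee τ≠∅ τ⊆e′ τ⊆e ch′ ch)

open import Data.Nat.Base using (z≤n; s≤s; _+_; _*_; _^_; _≤_; _<_)
open ≡ using (refl; sym; trans; cong; cong₂; subst)

-- Sparse hypergraphs have few colours

module ℕ-Sum = Semiring-Sum ℕ.+-*-semiring
open ℕ-Sum using (sum)

-- Once f x is removed from ys, the images of the other elements are still there, as they differ
-- from f x.
injection⇒length≤ : ∀ {A B : Set} (f : A → B) {xs ys} → Unique xs → (∀ {x} → x ∈ˡ xs → f x ∈ˡ ys) →
  (∀ {x y} → x ∈ˡ xs → y ∈ˡ xs → f x ≡ f y → x ≡ y) → length xs ≤ length ys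
injection⇒length≤ f {[]} _ _ _ = z≤n
injection⇒length≤ f {x ∷ xs} (x∉xs ∷ uniq) f∈ inj with ∈-∃++ (f∈ (here refl))
... | as , bs , refl = begin
    suc (length xs)               ≤⟨ s≤s (injection⇒length≤ f uniq f∈′ (λ p q → inj (there p) (there q))) ⟩
    suc (length (as ++ bs))       ≡⟨ cong suc (List.length-++ as) ⟩
    suc (length as + length bs)   ≡⟨ ℕ.+-suc (length as) (length bs) ⟨
    length as + suc (length bs)   ≡⟨ List.length-++ as ⟨
    length (as ++ f x ∷ bs)       ∎
  where
  open ℕ.≤-Reasoning
  f∈′ : ∀ {y} → y ∈ˡ xs → f y ∈ˡ as ++ bs
  f∈′ {y} y∈xs with ∈-++⁻ as (f∈ (there y∈xs))
  ... | inj₁ ∈as         = ∈-++⁺ˡ ∈as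
  ... | inj₂ (there ∈bs) = ∈-++⁺ʳ as ∈bs
  ... | inj₂ (here fy≡fx) = contradiction (inj (here refl) (there y∈xs) (sym fy≡fx)) (All.lookup x∉xs y∈xs)

subsets-unique : ∀ n → Unique (subsets n)
subsets-unique zero    = [] ∷ []
subsets-unique (suc n) = Unique.++⁺
  (Unique.map⁺ (λ { refl → refl }) (subsets-unique n)) (Unique.map⁺ (λ { refl → refl }) (subsets-unique n))
  λ (p , q) → disjoint (∈-map⁻ (inside ∷_) p) (∈-map⁻ (outside ∷_) q)
  where
  disjoint : ∀ {s : Subset (suc n)} →
    (∃ λ t → t ∈ˡ subsets n × s ≡ inside ∷ t) → ¬ (∃ λ t → t ∈ˡ subsets n × s ≡ outside ∷ t)
  disjoint (_ , _ , refl) (_ , _ , ())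

elements : ∀ {n} → Subset n → List (Fin n)
elements []            = []
elements (inside ∷ s)  = zero ∷ map suc (elements s)
elements (outside ∷ s) = map suc (elements s)

length-elements : ∀ {n} (s : Subset n) → length (elements s) ≡ ∣ s ∣
length-elements []            = refl
length-elements (inside ∷ s)  = cong suc (trans (List.length-map suc (elements s)) (length-elements s))
length-elements (outside ∷ s) = trans (List.length-map suc (elements s)) (length-elements s)

∈-elements : ∀ {n} {s : Subset n} {v} → v ∈ s → v ∈ˡ elements s
∈-elements {s = inside ∷ s}  here        = here refl
∈-elements {s = inside ∷ s}  (there v∈s) = there (∈-map⁺ suc (∈-elements v∈s))
∈-elements {s = outside ∷ s} (there v∈s) = ∈-map⁺ suc (∈-elements v∈s)

-- Unions of k singletons with repetitions allowed: sets of fewer than k elements occur too, and the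
-- length is at most a plain power. As only nonempty sets are wanted, k = 0 gives the empty list.
smallSubsets : ∀ {n} → Subset n → ℕ → List (Subset n)
smallSubsets W zero          = []
smallSubsets W (suc zero)    = map ⁅_⁆ (elements W)
smallSubsets W (suc (suc k)) = cartesianProductWith (λ v s → ⁅ v ⁆ ∪ s) (elements W) (smallSubsets W (suc k))

length-cartesianProductWith : ∀ {A B C : Set} (f : A → B → C) xs ys →
  length (cartesianProductWith f xs ys) ≡ length xs * length ys
length-cartesianProductWith f []       ys = refl
length-cartesianProductWith f (x ∷ xs) ys = trans (List.length-++ (map (f x) ys))
  (cong₂ _+_ (List.length-map (f x) ys) (length-cartesianProductWith f xs ys))

length-smallSubsets : ∀ {n} (W : Subset n) k → length (smallSubsets W k) ≤ ∣ W ∣ ^ k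
length-smallSubsets W zero          = z≤n
length-smallSubsets W (suc zero)    = ℕ.≤-reflexive
  (trans (List.length-map ⁅_⁆ (elements W)) (trans (length-elements W) (sym (ℕ.*-identityʳ ∣ W ∣))))
length-smallSubsets W (suc (suc k)) = begin
  length (smallSubsets W (2 + k))                             ≡⟨ length-cartesianProductWith _ (elements W) _ ⟩
  length (elements W) * length (smallSubsets W (suc k))
    ≡⟨ cong (_* length (smallSubsets W (suc k))) (length-elements W) ⟩
  ∣ W ∣ * length (smallSubsets W (suc k))                     ≤⟨ ℕ.*-monoʳ-≤ ∣ W ∣ (length-smallSubsets W (suc k)) ⟩
  ∣ W ∣ * ∣ W ∣ ^ suc k                                       ∎
  where open ℕ.≤-Reasoning

⁅v⁆∪[s-v]≡s : ∀ {n} {s : Subset n} {v} → v ∈ s → ⁅ v ⁆ ∪ (s - v) ≡ s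
⁅v⁆∪[s-v]≡s {s = s} {v} v∈s = ⊆-antisym ⊆ˡ ⊆ʳ
  where
  ⊆ˡ : ⁅ v ⁆ ∪ (s - v) ⊆ s
  ⊆ˡ w∈ with x∈p∪q⁻ ⁅ v ⁆ (s - v) w∈
  ... | inj₁ w∈v = subst (_∈ s) (sym (x∈⁅y⁆⇒x≡y v w∈v)) v∈s
  ... | inj₂ w∈s = p─q⊆p s ⁅ v ⁆ w∈s
  ⊆ʳ : s ⊆ ⁅ v ⁆ ∪ (s - v)
  ⊆ʳ {w} w∈s with w ≟ꟳ v
  ... | yes refl = x∈p∪q⁺ (inj₁ (x∈⁅x⁆ w))
  ... | no  w≢v  = x∈p∪q⁺ (inj₂ (x∈p∧x≢y⇒x∈p-y w∈s w≢v))

∈-smallSubsets : ∀ {n} (W : Subset n) k {s} → s ⊆ W → Nonempty s → ∣ s ∣ ≤ k → s ∈ˡ smallSubsets W k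
∈-smallSubsets W k {s} s⊆W (v , v∈s) ∣s∣≤k with nonempty? (s - v)
∈-smallSubsets W zero          s⊆W (v , v∈s) ∣s∣≤k | _ =
  contradiction (ℕ.≤-trans (x∈p⇒∣p-x∣<∣p∣ v∈s) ∣s∣≤k) λ ()
∈-smallSubsets W (suc zero) {s} s⊆W (v , v∈s) ∣s∣≤k | yes (w , w∈) =
  contradiction (ℕ.≤-trans (x∈p⇒∣p-x∣<∣p∣ v∈s) ∣s∣≤k)
    (ℕ.<⇒≱ (s≤s (ℕ.≤-trans (s≤s z≤n) (x∈p⇒∣p-x∣<∣p∣ w∈))))
∈-smallSubsets W (suc zero) {s} s⊆W (v , v∈s) ∣s∣≤k | no empty =
  subst (_∈ˡ smallSubsets W 1) eq (∈-map⁺ ⁅_⁆ (∈-elements (s⊆W v∈s)))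
  where
  eq : ⁅ v ⁆ ≡ s
  eq = trans (sym (∪-identityʳ ⁅ v ⁆)) (trans (cong (⁅ v ⁆ ∪_) (sym (Empty-unique empty))) (⁅v⁆∪[s-v]≡s v∈s))
∈-smallSubsets W (suc (suc k)) {s} s⊆W (v , v∈s) ∣s∣≤k | yes ne =
  subst (_∈ˡ smallSubsets W (2 + k)) (⁅v⁆∪[s-v]≡s v∈s)
    (∈-cartesianProductWith⁺ (λ v s → ⁅ v ⁆ ∪ s) (∈-elements (s⊆W v∈s))
      (∈-smallSubsets W (suc k) (s⊆W ∘ p─q⊆p s ⁅ v ⁆) ne (ℕ.≤-pred (ℕ.≤-trans (x∈p⇒∣p-x∣<∣p∣ v∈s) ∣s∣≤k))))
-- Here s consists of v alone, and v is repeated.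
∈-smallSubsets W (suc (suc k)) {s} s⊆W (v , v∈s) ∣s∣≤k | no empty =
  subst (_∈ˡ smallSubsets W (2 + k)) eq
    (∈-cartesianProductWith⁺ (λ v s → ⁅ v ⁆ ∪ s) (∈-elements (s⊆W v∈s))
      (∈-smallSubsets W (suc k) {⁅ v ⁆}
        (λ w∈ → subst (_∈ W) (sym (x∈⁅y⁆⇒x≡y v w∈)) (s⊆W v∈s)) (v , x∈⁅x⁆ v)
        (ℕ.≤-trans (ℕ.≤-reflexive (∣⁅x⁆∣≡1 v)) (s≤s z≤n))))
  where
  eq : ⁅ v ⁆ ∪ ⁅ v ⁆ ≡ s
  eq = trans (∪-idem ⁅ v ⁆) (trans (sym (∪-identityʳ ⁅ v ⁆))
    (trans (cong (⁅ v ⁆ ∪_) (sym (Empty-unique empty))) (⁅v⁆∪[s-v]≡s v∈s)))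

∣p∪q∣≤∣p∣+∣q∣ : ∀ {n} (p q : Subset n) → ∣ p ∪ q ∣ ≤ ∣ p ∣ + ∣ q ∣
∣p∪q∣≤∣p∣+∣q∣ []            []            = z≤n
∣p∪q∣≤∣p∣+∣q∣ (outside ∷ p) (outside ∷ q) = ∣p∪q∣≤∣p∣+∣q∣ p q
∣p∪q∣≤∣p∣+∣q∣ (outside ∷ p) (inside ∷ q)  =
  ℕ.≤-trans (s≤s (∣p∪q∣≤∣p∣+∣q∣ p q)) (ℕ.≤-reflexive (sym (ℕ.+-suc ∣ p ∣ ∣ q ∣)))
∣p∪q∣≤∣p∣+∣q∣ (inside ∷ p)  (outside ∷ q) = s≤s (∣p∪q∣≤∣p∣+∣q∣ p q)
∣p∪q∣≤∣p∣+∣q∣ (inside ∷ p)  (inside ∷ q)  =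
  s≤s (ℕ.≤-trans (∣p∪q∣≤∣p∣+∣q∣ p q) (ℕ.+-monoʳ-≤ ∣ p ∣ (ℕ.n≤1+n ∣ q ∣)))

transversal : ∀ {n} → List (Subset n) → Subset n
transversal []       = ⊥
transversal (e ∷ es) with nonempty? e
... | yes (v , _) = ⁅ v ⁆ ∪ transversal es
... | no  _       = transversal es

∣transversal∣ : ∀ {n} (es : List (Subset n)) → ∣ transversal es ∣ ≤ length es
∣transversal∣ {n} []   = ℕ.≤-reflexive (∣⊥∣≡0 n)
∣transversal∣ (e ∷ es) with nonempty? e
... | yes (v , _) = ℕ.≤-trans (∣p∪q∣≤∣p∣+∣q∣ ⁅ v ⁆ (transversal es))
                      (ℕ.+-mono-≤ (ℕ.≤-reflexive (∣⁅x⁆∣≡1 v)) (∣transversal∣ es))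
... | no  _       = ℕ.m≤n⇒m≤1+n (∣transversal∣ es)

transversal-meets : ∀ {n} {es : List (Subset n)} {e} → e ∈ˡ es → Nonempty e → ∃ λ v → v ∈ e × v ∈ transversal es
transversal-meets {es = e ∷ es} (here refl) ne with nonempty? e
... | yes (v , v∈e) = v , v∈e , x∈p∪q⁺ (inj₁ (x∈⁅x⁆ v))
... | no  empty     = contradiction ne empty
transversal-meets {es = e ∷ es} (there e∈es) ne with nonempty? e | transversal-meets e∈es ne
... | yes (v , _) | w , w∈e , w∈ = w , w∈e , x∈p∪q⁺ (inj₂ w∈)
... | no  _       | result       = result

sum-minimum : ∀ {q} (g : Fin (suc q) → ℕ) → ∃ λ c → suc q * g c ≤ sum g
sum-minimum {zero}  g = zero , ℕ.≤-refl
sum-minimum {suc q} g with sum-minimum (g ∘ suc)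
... | c , h with g zero ℕ.≤? g (suc c)
... | yes p = zero , ℕ.+-monoʳ-≤ (g zero) (ℕ.≤-trans (ℕ.*-monoʳ-≤ (suc q) p) h)
... | no ¬p = suc c , ℕ.+-mono-≤ (ℕ.<⇒≤ (ℕ.≰⇒> ¬p)) h

sum-delta : ∀ {q} (c : Fin q) x → sum (λ c₀ → if does (c ≟ꟳ c₀) then x else 0) ≡ x
sum-delta {suc q} zero    x = trans (cong (x +_) (ℕ-Sum.sum-replicate-zero q)) (ℕ.+-identityʳ x)
sum-delta {suc q} (suc c) x = sum-delta c x

-- Derandomization of a uniformly random colouring with q colours, by conditional expectations. A demand
-- (s , c , t) is met if s is coloured c throughout, which has probability cost s / q ^ n; t is a tag.
module Averaging (A : Set) (p : ℕ) where

  q : ℕ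
  q = suc p

  Demand : ℕ → Set
  Demand n = Subset n × Fin q × A

  -- Conditioning on the colour c₀ of vertex zero: demands that it violates disappear, the others
  -- lose that vertex.
  restrict : ∀ {n} → Fin q → List (Demand (suc n)) → List (Demand n)
  restrict c₀ []                        = []
  restrict c₀ ((outside ∷ s , c , t) ∷ R) = (s , c , t) ∷ restrict c₀ R
  restrict c₀ ((inside ∷ s , c , t) ∷ R)  =
    if does (c ≟ꟳ c₀) then (s , c , t) ∷ restrict c₀ R else restrict c₀ R

  met : ∀ {n} → Vec (Fin q) n → List (Demand n) → List A
  met []      R = map (λ (_ , _ , t) → t) R
  met (c ∷ f) R = met f (restrict c R)

  cost : ∀ {n} → Subset n → ℕ
  cost []            = 1
  cost (inside ∷ s)  = cost s
  cost (outside ∷ s) = q * cost s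

  totalCost : ∀ {n} → List (Demand n) → ℕ
  totalCost []                = 0
  totalCost ((s , _ , _) ∷ R) = cost s + totalCost R

  cost-spec : ∀ {n} (s : Subset n) → cost s * q ^ ∣ s ∣ ≡ q ^ n
  cost-spec []            = refl
  cost-spec (inside ∷ s)  = trans
    (solve 3 (λ c q x → c :* (q :* x) := q :* (c :* x)) refl (cost s) q (q ^ ∣ s ∣)) (cong (q *_) (cost-spec s))
    where open ℕ-Solver
  cost-spec (outside ∷ s) = trans (ℕ.*-assoc q (cost s) (q ^ ∣ s ∣)) (cong (q *_) (cost-spec s))

  ∈-restrict-out : ∀ {n} c₀ {R : List (Demand (suc n))} {s c t} →
    (outside ∷ s , c , t) ∈ˡ R → (s , c , t) ∈ˡ restrict c₀ R
  ∈-restrict-out c₀ (here refl) = here refl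
  ∈-restrict-out c₀ {(outside ∷ _ , _) ∷ R} (there h) = there (∈-restrict-out c₀ h)
  ∈-restrict-out c₀ {(inside ∷ _ , c , _) ∷ R} (there h) with does (c ≟ꟳ c₀)
  ... | true  = there (∈-restrict-out c₀ h)
  ... | false = ∈-restrict-out c₀ h

  ∈-restrict-in : ∀ {n} c {R : List (Demand (suc n))} {s t} →
    (inside ∷ s , c , t) ∈ˡ R → (s , c , t) ∈ˡ restrict c R
  ∈-restrict-in c (here refl) with c ≟ꟳ c
  ... | yes _  = here refl
  ... | no c≢c = contradiction refl c≢c
  ∈-restrict-in c {(outside ∷ _ , _) ∷ R} (there h) = there (∈-restrict-in c h)
  ∈-restrict-in c {(inside ∷ _ , c′ , _) ∷ R} (there h) with does (c′ ≟ꟳ c)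
  ... | true  = there (∈-restrict-in c h)
  ... | false = ∈-restrict-in c h

  ∈-met : ∀ {n} (f : Vec (Fin q) n) {R s c t} → (s , c , t) ∈ˡ R → (∀ v → v ∈ s → lookup f v ≡ c) → t ∈ˡ met f R
  ∈-met []       h _ = ∈-map⁺ (λ (_ , _ , t) → t) h
  ∈-met (c₀ ∷ f) {s = inside ∷ s} h sat with sat zero here
  ... | refl = ∈-met f (∈-restrict-in c₀ h) (λ v v∈s → sat (suc v) (there v∈s))
  ∈-met (c₀ ∷ f) {s = outside ∷ s} h sat = ∈-met f (∈-restrict-out c₀ h) (λ v v∈s → sat (suc v) (there v∈s))

  -- A demand without vertex zero survives all q choices, each time at a q-th of its cost; a demand
  -- containing it survives exactly one choice, at full cost.
  totalCost-restrict : ∀ {n} (R : List (Demand (suc n))) → sum (λ c₀ → totalCost (restrict c₀ R)) ≡ totalCost R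
  totalCost-restrict [] = ℕ-Sum.sum-replicate-zero q
  totalCost-restrict ((outside ∷ s , c , t) ∷ R) = trans
    (ℕ-Sum.∑-distrib-+ (λ _ → cost s) (λ c₀ → totalCost (restrict c₀ R)))
    (cong₂ _+_ (constant q) (totalCost-restrict R))
    where
    constant : ∀ r → sum {r} (λ _ → cost s) ≡ r * cost s
    constant zero    = refl
    constant (suc r) = cong (cost s +_) (constant r)
  totalCost-restrict ((inside ∷ s , c , t) ∷ R) = begin
    sum (λ c₀ → totalCost (restrict c₀ ((inside ∷ s , c , t) ∷ R)))
      ≡⟨ ℕ-Sum.sum-cong-≗ step ⟩
    sum (λ c₀ → (if does (c ≟ꟳ c₀) then cost s else 0) + totalCost (restrict c₀ R))
      ≡⟨ ℕ-Sum.∑-distrib-+ (λ c₀ → if does (c ≟ꟳ c₀) then cost s else 0) (λ c₀ → totalCost (restrict c₀ R)) ⟩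
    sum (λ c₀ → if does (c ≟ꟳ c₀) then cost s else 0) + sum (λ c₀ → totalCost (restrict c₀ R))
      ≡⟨ cong₂ _+_ (sum-delta c (cost s)) (totalCost-restrict R) ⟩
    cost s + totalCost R ∎
    where
    open ≡-Reasoning
    step : ∀ c₀ → totalCost (restrict c₀ ((inside ∷ s , c , t) ∷ R)) ≡
      (if does (c ≟ꟳ c₀) then cost s else 0) + totalCost (restrict c₀ R)
    step c₀ with does (c ≟ꟳ c₀)
    ... | true  = refl
    ... | false = refl

  -- For each vertex in turn, some colour leaves at most a q-th of the present total cost.
  few-met : ∀ n (R : List (Demand n)) → ∃ λ f → q ^ n * length (met f R) ≤ totalCost R
  few-met zero R = [] , ℕ.≤-reflexive (trans (ℕ.*-identityˡ _) (trans (List.length-map _ R) (count R)))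
    where
    count : ∀ R → length R ≡ totalCost R
    count []               = refl
    count (([] , _) ∷ R)   = cong suc (count R)
  few-met (suc n) R =
    let c , c-small = sum-minimum (λ c₀ → totalCost (restrict c₀ R))
        f , f-small = few-met n (restrict c R)
    in c ∷ f , (begin
      q * q ^ n * length (met f (restrict c R))    ≡⟨ ℕ.*-assoc q (q ^ n) _ ⟩
      q * (q ^ n * length (met f (restrict c R)))  ≤⟨ ℕ.*-monoʳ-≤ q f-small ⟩
      q * totalCost (restrict c R)                 ≤⟨ c-small ⟩
      sum (λ c₀ → totalCost (restrict c₀ R))       ≡⟨ totalCost-restrict R ⟩
      totalCost R                                  ∎)
    where open ℕ.≤-Reasoning

-- Each edge demands every one of the q colours, which costs q ^ (n - d) in all, a fraction 1 / q ^
-- d of the colourings. The tag preserves the edge while `restrict` strips the demand of its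
-- vertices.
few-monochromatic : ∀ {n} p d (es : List (Subset n)) → (∀ {e} → e ∈ˡ es → ∣ e ∣ ≡ suc d) →
  ∃ λ (f : Fin n → Fin (suc p)) → ∃ λ bad → suc p ^ d * length bad ≤ length es ×
    (∀ {e c} → e ∈ˡ es → (∀ v → v ∈ e → f v ≡ c) → e ∈ˡ bad)
few-monochromatic {n} p d es uniform =
  let f , small = few-met n (demands es)
  in lookup f , met f (demands es) , bound (length (met f (demands es))) small
   , λ {e} {c} e∈es mono → ∈-met f (∈-demands c e∈es) mono
  where
  open Averaging (Subset n) p
  demands : List (Subset n) → List (Demand n)
  demands []       = []
  demands (e ∷ es) = map (λ c → e , c , e) (allFin q) ++ demands es
  ∈-demands : ∀ {e es} c → e ∈ˡ es → (e , c , e) ∈ˡ demands es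
  ∈-demands c (here refl)          = ∈-++⁺ˡ (∈-map⁺ _ (∈-allFin c))
  ∈-demands {es = e ∷ es} c (there h) = ∈-++⁺ʳ (map (λ c → e , c , e) (allFin q)) (∈-demands c h)
  totalCost-++ : ∀ e cs R → totalCost (map (λ c → e , c , e) cs ++ R) ≡ length cs * cost e + totalCost R
  totalCost-++ e []       R = refl
  totalCost-++ e (c ∷ cs) R = trans (cong (cost e +_) (totalCost-++ e cs R)) (sym (ℕ.+-assoc (cost e) _ _))
  totalCost-demands : ∀ es → (∀ {e} → e ∈ˡ es → ∣ e ∣ ≡ suc d) → totalCost (demands es) * q ^ d ≡ length es * q ^ n
  totalCost-demands []       _ = refl
  totalCost-demands (e ∷ es) u = begin
    totalCost (demands (e ∷ es)) * q ^ d
      ≡⟨ cong (_* q ^ d) (totalCost-++ e (allFin q) (demands es)) ⟩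
    (length (allFin q) * cost e + totalCost (demands es)) * q ^ d
      ≡⟨ cong (λ l → (l * cost e + totalCost (demands es)) * q ^ d) (List.length-tabulate {n = q} id) ⟩
    (q * cost e + totalCost (demands es)) * q ^ d
      ≡⟨ solve 4 (λ q c t x → (q :* c :+ t) :* x := c :* (q :* x) :+ t :* x) refl
           q (cost e) (totalCost (demands es)) (q ^ d) ⟩
    cost e * q ^ suc d + totalCost (demands es) * q ^ d
      ≡⟨ cong₂ _+_ (trans (cong (λ m → cost e * q ^ m) (sym (u (here refl)))) (cost-spec e))
           (totalCost-demands es (u ∘ there)) ⟩
    q ^ n + length es * q ^ n ∎
    where
    open ≡-Reasoning
    open ℕ-Solver
  bound : ∀ m → q ^ n * m ≤ totalCost (demands es) → q ^ d * m ≤ length es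
  bound m h = ℕ.*-cancelʳ-≤ (q ^ d * m) (length es) (q ^ n) {{ℕ.m^n≢0 q n}} (begin
    q ^ d * m * q ^ n                    ≡⟨ solve 3 (λ a b c → a :* b :* c := c :* b :* a) refl (q ^ d) m (q ^ n) ⟩
    q ^ n * m * q ^ d                    ≤⟨ ℕ.*-monoˡ-≤ (q ^ d) h ⟩
    totalCost (demands es) * q ^ d       ≡⟨ totalCost-demands es uniform ⟩
    length es * q ^ n                    ∎)
    where
    open ℕ.≤-Reasoning
    open ℕ-Solver

-- The first summand is the number of colours for k = 1, the second the constant factor for k ≥ 2.
colourConstant : (d k′ : ℕ) → ℕ
colourConstant d k′ = suc (2 * (2 + d)) + 8 * 2 ^ k′

-- The dimension is `suc d` and k is `suc k′`, which builds in that both are positive.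
module Colouring {n} (E : Subset n → Set) (E? : Decidable E) (d k′ : ℕ)
                 (uniform : ∀ e → E e → ∣ e ∣ ≡ 2 + d) where

  edges : Subset n → List (Subset n)
  edges W = filter (λ e → E? e ×-dec e ⊆? W) (subsets n)

  ∈-edges : ∀ {W e} → E e → e ⊆ W → e ∈ˡ edges W
  ∈-edges {W} {e} Ee e⊆W = ∈-filter⁺ (λ e → E? e ×-dec e ⊆? W) (∈-subsets e) (Ee , e⊆W)

  edges-sound : ∀ {W e} → e ∈ˡ edges W → E e × e ⊆ W
  edges-sound {W} e∈ = proj₂ (∈-filter⁻ (λ e → E? e ×-dec e ⊆? W) {xs = subsets n} e∈)

  edge-nonempty : ∀ {e} → E e → Nonempty e
  edge-nonempty {e} Ee = 0<∣s∣⇒nonempty e (subst (0 <_) (sym (uniform e Ee)) (s≤s z≤n))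

  Sparse : Set
  Sparse = ∀ W → length (edges W) ≤ 2 * ∣ W ∣ ^ suc k′

  -- The face charged by an edge inside W is itself a nonempty subset of W with at most k elements,
  -- and there are two signs.
  charging⇒sparse : Charging E (suc k′) → Sparse
  charging⇒sparse (charge , props , injective) W = begin
    length (edges W)
      ≤⟨ injection⇒length≤ charge (Unique.filter⁺ (λ e → E? e ×-dec e ⊆? W) (subsets-unique n)) charge∈
           (λ p q → injective _ _ (proj₁ (edges-sound p)) (proj₁ (edges-sound q))) ⟩
    length (cartesianProduct (true ∷ false ∷ []) (smallSubsets W (suc k′)))
      ≡⟨ length-cartesianProductWith _,_ (true ∷ false ∷ []) (smallSubsets W (suc k′)) ⟩
    2 * length (smallSubsets W (suc k′))
      ≤⟨ ℕ.*-monoʳ-≤ 2 (length-smallSubsets W (suc k′)) ⟩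
    2 * ∣ W ∣ ^ suc k′ ∎
    where
    open ℕ.≤-Reasoning
    bool∈ : ∀ b → b ∈ˡ true ∷ false ∷ []
    bool∈ true  = here refl
    bool∈ false = there (here refl)
    charge∈ : ∀ {e} → e ∈ˡ edges W → charge e ∈ˡ cartesianProduct (true ∷ false ∷ []) (smallSubsets W (suc k′))
    charge∈ {e} e∈ =
      let Ee , e⊆W = edges-sound e∈
          τ⊆e , τ≠∅ , small = props e Ee
      in ∈-cartesianProduct⁺ (bool∈ (proj₁ (charge e))) (∈-smallSubsets W (suc k′) (e⊆W ∘ τ⊆e) τ≠∅ small)

  sparse-stable : ¬ ¬ Sparse → Sparse
  sparse-stable h W = decidable-stable (length (edges W) ℕ.≤? 2 * ∣ W ∣ ^ suc k′) (λ ¬s → h λ s → ¬s (s W))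

  -- All vertices get colours, but only edges inside W are tested, so passing to a smaller set
  -- leaves the vertex type alone.
  Colourable : ℕ → Subset n → Set
  Colourable m W = ∃ λ (c : Fin n → Fin m) → ∀ e → E e → e ⊆ W → ∀ i → ¬ (∀ v → v ∈ e → c v ≡ i)

  colourable-mono : ∀ {m m′ W} → m ≤ m′ → Colourable m W → Colourable m′ W
  colourable-mono m≤m′ (c , proper) = (λ v → inject≤ (c v) m≤m′) , λ e Ee e⊆W i mono →
    -- The colour i need not come from the smaller palette, whereas that of a vertex of e does.
    let v₀ , v₀∈e = edge-nonempty Ee
    in proper e Ee e⊆W (c v₀) λ v v∈e →
      inject≤-injective m≤m′ m≤m′ (c v) (c v₀) (trans (mono v v∈e) (sym (mono v₀ v₀∈e)))

  colourable-edgeless : ∀ {W} → (∀ e → E e → ¬ e ⊆ W) → Colourable 1 W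
  colourable-edgeless none = (λ _ → zero) , λ e Ee e⊆W _ _ → none e Ee e⊆W

  -- An edge monochromatic in a fresh colour lies in T, where g is proper. One monochromatic in an
  -- old colour misses T and is monochromatic for f, but such edges meet T.
  colourable-transversal : ∀ {q m W T} (f : Fin n → Fin q) →
    (∀ e c → E e → e ⊆ W → (∀ v → v ∈ e → f v ≡ c) → ∃ λ v → v ∈ e × v ∈ T) →
    Colourable m T → Colourable (q + m) W
  colourable-transversal {q} {m} {W} {T} f meets (g , proper) = c , λ e Ee e⊆W i mono → refute e Ee e⊆W i mono
    where
    c : Fin n → Fin (q + m)
    c v with v ∈? T
    ... | yes _ = q ↑ʳ g v
    ... | no  _ = f v ↑ˡ m
    c-spec : ∀ v → (v ∈ T × splitAt q (c v) ≡ inj₂ (g v)) ⊎ (v ∉ T × splitAt q (c v) ≡ inj₁ (f v))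
    c-spec v with v ∈? T
    ... | yes v∈T = inj₁ (v∈T , splitAt-↑ʳ q m (g v))
    ... | no  v∉T = inj₂ (v∉T , splitAt-↑ˡ q (f v) m)
    refute : ∀ e → E e → e ⊆ W → ∀ i → ¬ (∀ v → v ∈ e → c v ≡ i)
    refute e Ee e⊆W i mono with splitAt q i in eq
    ... | inj₁ j = let v , v∈e , v∈T = meets e j Ee e⊆W (λ v v∈e → proj₂ (old v v∈e)) in proj₁ (old v v∈e) v∈T
      where
      old : ∀ v → v ∈ e → v ∉ T × f v ≡ j
      old v v∈e with c-spec v
      ... | inj₁ (_ , s)   with () ← trans (sym s) (trans (cong (splitAt q) (mono v v∈e)) eq)
      ... | inj₂ (v∉T , s) with refl ← trans (sym s) (trans (cong (splitAt q) (mono v v∈e)) eq) = v∉T , refl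
    ... | inj₂ j = proper e Ee (λ {v} v∈e → proj₁ (new v v∈e)) j (λ v v∈e → proj₂ (new v v∈e))
      where
      new : ∀ v → v ∈ e → v ∈ T × g v ≡ j
      new v v∈e with c-spec v
      ... | inj₂ (_ , s)   with () ← trans (sym s) (trans (cong (splitAt q) (mono v v∈e)) eq)
      ... | inj₁ (v∈T , s) with refl ← trans (sym s) (trans (cong (splitAt q) (mono v v∈e)) eq) = v∈T , refl

  -- The case k ≥ 2: recursion over scales

  module _ (sparse : Sparse) where

    D : ℕ
    D = suc d

    -- The power of two is the exact `D`-th root of (2 ^ (D J)) ^ k′. Of the factor 4 = 2 * 2,
    -- raised to the power `D`, one half pays for shrinking the set by 2 ^ D and the other covers
    -- the factor 2 in `Sparse`.
    palette : ℕ → ℕ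
    palette J = 4 * 2 ^ (J * k′)

    -- To colour W with ∣ W ∣ ≤ 2 ^ (D (1 + j)): palette (1 + j) colours leave few monochromatic edges,
    -- and one vertex from each of them makes up a set of size at most 2 ^ (D j), coloured with fresh colours.
    totalPalette : ℕ → ℕ
    totalPalette zero    = 1
    totalPalette (suc j) = palette (suc j) + totalPalette j

    2^[D*J]^ : ∀ J m → (2 ^ (D * J)) ^ m ≡ (2 ^ (J * m)) ^ D
    2^[D*J]^ J m = trans (ℕ.^-*-assoc 2 (D * J) m) (trans
      (cong (2 ^_) (solve 3 (λ d j m → d :* j :* m := j :* m :* d) refl D J m)) (sym (ℕ.^-*-assoc 2 (J * m) D)))
      where open ℕ-Solver

    palette-nonZero : ∀ J → NonZero (palette J)
    palette-nonZero J = ℕ.m*n≢0 4 (2 ^ (J * k′)) {{_}} {{ℕ.m^n≢0 2 (J * k′)}}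

    few-bad : ∀ W j b → ∣ W ∣ ≤ 2 ^ (D * suc j) → palette (suc j) ^ D * b ≤ length (edges W) → b ≤ 2 ^ (D * j)
    few-bad W j b small few =
      ℕ.*-cancelˡ-≤ (palette (suc j) ^ D) {{ℕ.m^n≢0 (palette (suc j)) D {{palette-nonZero (suc j)}}}} (begin
        palette (suc j) ^ D * b
          ≤⟨ few ⟩
        length (edges W)
          ≤⟨ sparse W ⟩
        2 * ∣ W ∣ ^ suc k′
          ≤⟨ ℕ.*-monoʳ-≤ 2 (ℕ.^-monoˡ-≤ (suc k′) small) ⟩
        2 * (2 ^ (D * suc j) * (2 ^ (D * suc j)) ^ k′)
          ≡⟨ cong₂ (λ x y → 2 * (x * y)) (trans (cong (2 ^_) (ℕ.*-suc D j)) (ℕ.^-distribˡ-+-* 2 D (D * j)))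
               (2^[D*J]^ (suc j) k′) ⟩
        2 * (2 ^ D * 2 ^ (D * j) * (2 ^ (suc j * k′)) ^ D)
          ≡⟨ solve 3 (λ x y z → con 2 :* (x :* y :* z) := con 2 :* x :* z :* y) refl
               (2 ^ D) (2 ^ (D * j)) ((2 ^ (suc j * k′)) ^ D) ⟩
        2 * 2 ^ D * (2 ^ (suc j * k′)) ^ D * 2 ^ (D * j)
          ≤⟨ ℕ.*-monoˡ-≤ (2 ^ (D * j)) (ℕ.*-monoˡ-≤ ((2 ^ (suc j * k′)) ^ D) 2*2^D≤4^D) ⟩
        4 ^ D * (2 ^ (suc j * k′)) ^ D * 2 ^ (D * j)
          ≡⟨ cong (_* 2 ^ (D * j)) (^-distribʳ-* D 4 (2 ^ (suc j * k′))) ⟨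
        palette (suc j) ^ D * 2 ^ (D * j) ∎)
      where
      open ℕ.≤-Reasoning
      open ℕ-Solver
      2*2^D≤4^D : 2 * 2 ^ D ≤ 4 ^ D
      2*2^D≤4^D = begin
        2 * 2 ^ D      ≤⟨ ℕ.*-monoˡ-≤ (2 ^ D) (ℕ.m≤m*n 2 (2 ^ d) {{ℕ.m^n≢0 2 d}}) ⟩
        2 ^ D * 2 ^ D  ≡⟨ ^-distribʳ-* D 2 2 ⟨
        4 ^ D          ∎

    colourable-totalPalette : ∀ j W → ∣ W ∣ ≤ 2 ^ (D * j) → Colourable (totalPalette j) W
    colourable-totalPalette zero W small = colourable-edgeless λ e Ee e⊆W →
      contradiction (begin
        2              ≤⟨ s≤s (s≤s z≤n) ⟩
        2 + d          ≡⟨ uniform e Ee ⟨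
        ∣ e ∣          ≤⟨ p⊆q⇒∣p∣≤∣q∣ e⊆W ⟩
        ∣ W ∣          ≤⟨ small ⟩
        2 ^ (D * 0)    ≡⟨ cong (2 ^_) (ℕ.*-zeroʳ D) ⟩
        1              ∎) (ℕ.<-irrefl refl)
      where open ℕ.≤-Reasoning
    colourable-totalPalette (suc j) W small =
      let p = ℕ.pred (palette (suc j))
          1+p≡palette : suc p ≡ palette (suc j)
          1+p≡palette = ℕ.suc-pred (palette (suc j)) {{palette-nonZero (suc j)}}
          f , bad , few , bad-complete = few-monochromatic p D (edges W) (λ e∈ → uniform _ (proj₁ (edges-sound e∈)))
          T = transversal bad
      in subst (λ q → Colourable (q + totalPalette j) W) 1+p≡palette
        (colourable-transversal f
          (λ e c Ee e⊆W mono → transversal-meets (bad-complete (∈-edges Ee e⊆W) mono) (edge-nonempty Ee))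
          (colourable-totalPalette j T (ℕ.≤-trans (∣transversal∣ bad)
            (few-bad W j (length bad) small (subst (λ q → q ^ D * length bad ≤ length (edges W)) 1+p≡palette few)))))

    -- A geometric series with ratio 2 ^ k′ ≥ 2 is at most twice its last term, hence 8 = 2 * 4.
    totalPalette-bound : 1 ≤ k′ → ∀ j → totalPalette j ≤ 8 * 2 ^ (j * k′)
    totalPalette-bound 1≤k′ zero    = s≤s z≤n
    totalPalette-bound 1≤k′ (suc j) = begin
      4 * 2 ^ (k′ + j * k′) + totalPalette j
        ≤⟨ ℕ.+-monoʳ-≤ (4 * 2 ^ (k′ + j * k′)) (totalPalette-bound 1≤k′ j) ⟩
      4 * 2 ^ (k′ + j * k′) + 8 * 2 ^ (j * k′)
        ≡⟨ cong (4 * 2 ^ (k′ + j * k′) +_) (solve 1 (λ x → con 8 :* x := con 4 :* (con 2 :* x)) refl (2 ^ (j * k′))) ⟩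
      4 * 2 ^ (k′ + j * k′) + 4 * 2 ^ suc (j * k′)
        ≤⟨ ℕ.+-monoʳ-≤ (4 * 2 ^ (k′ + j * k′)) (ℕ.*-monoʳ-≤ 4 (ℕ.^-monoʳ-≤ 2 (ℕ.+-monoˡ-≤ (j * k′) 1≤k′))) ⟩
      4 * 2 ^ (k′ + j * k′) + 4 * 2 ^ (k′ + j * k′)
        ≡⟨ solve 1 (λ x → con 4 :* x :+ con 4 :* x := con 8 :* x) refl (2 ^ (k′ + j * k′)) ⟩
      8 * 2 ^ (k′ + j * k′) ∎
      where
      open ℕ.≤-Reasoning
      open ℕ-Solver

    -- Descending from m finds the least scale j that accommodates N. If j is positive, scale j - 1
    -- is too small, so r = 2 ^ ((j - 1) k′) is below the root of N ^ k′ and only a factor 2 ^ k′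
    -- short of 2 ^ (j k′).
    scale-of : ∀ m N → 1 ≤ N → N ≤ 2 ^ (D * m) →
      ∃ λ j → N ≤ 2 ^ (D * j) × (∃ λ r → r ^ D ≤ N ^ k′ × 2 ^ (j * k′) ≤ 2 ^ k′ * r)
    scale-of zero N 1≤N N≤ = 0 , N≤ , 1 ,
      ℕ.≤-trans (ℕ.≤-reflexive (ℕ.^-zeroˡ D)) (ℕ.m^n>0 N {{ℕ.>-nonZero 1≤N}} k′) ,
      ℕ.≤-trans (ℕ.m^n>0 2 k′) (ℕ.≤-reflexive (sym (ℕ.*-identityʳ _)))
    scale-of (suc m) N 1≤N N≤ with N ℕ.≤? 2 ^ (D * m)
    ... | yes N≤′ = scale-of m N 1≤N N≤′
    ... | no  N≰′ = suc m , N≤ , 2 ^ (m * k′) ,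
          ℕ.≤-trans (ℕ.≤-reflexive (sym (2^[D*J]^ m k′))) (ℕ.^-monoˡ-≤ k′ (ℕ.<⇒≤ (ℕ.≰⇒> N≰′))) ,
          ℕ.≤-reflexive (ℕ.^-distribˡ-+-* 2 k′ (m * k′))

    n≤2^n : ∀ N → N ≤ 2 ^ N
    n≤2^n zero    = z≤n
    n≤2^n (suc N) = begin
      1 + N           ≤⟨ ℕ.+-mono-≤ (ℕ.m^n>0 2 N) (n≤2^n N) ⟩
      2 ^ N + 2 ^ N   ≡⟨ cong (2 ^ N +_) (ℕ.+-identityʳ (2 ^ N)) ⟨
      2 ^ suc N       ∎
      where open ℕ.≤-Reasoning

    colouring-bound : 1 ≤ k′ → 1 ≤ n → ∃ λ m → Colourable m ⊤ × ∃ λ r → r ^ D ≤ n ^ k′ × m ≤ 8 * 2 ^ k′ * r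
    colouring-bound 1≤k′ 1≤n =
      -- The scale n is a crude start, as n ≤ 2 ^ n ≤ 2 ^ (D n).
      let j , n≤ , r , r^D≤ , ≤r = scale-of n n 1≤n
            (ℕ.≤-trans (n≤2^n n) (ℕ.^-monoʳ-≤ 2 (ℕ.m≤n*m n D)))
      in totalPalette j , colourable-totalPalette j ⊤ (ℕ.≤-trans (ℕ.≤-reflexive (∣⊤∣≡n n)) n≤) , r , r^D≤ ,
         ℕ.≤-trans (totalPalette-bound 1≤k′ j)
           (ℕ.≤-trans (ℕ.*-monoʳ-≤ 8 ≤r) (ℕ.≤-reflexive (sym (ℕ.*-assoc 8 (2 ^ k′) r))))

  -- The case k = 1: vertices of low degree

  degree : List (Subset n) → Fin n → ℕ
  degree es v = length (filter (v ∈?_) es)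

  sum-degree : ∀ {s} es → (∀ {e} → e ∈ˡ es → ∣ e ∣ ≡ s) → sum (degree es) ≡ length es * s
  sum-degree []       _ = ℕ-Sum.sum-replicate-zero n
  sum-degree (e ∷ es) h = trans (ℕ-Sum.sum-cong-≗ step) (trans
    (ℕ-Sum.∑-distrib-+ (λ v → if does (v ∈? e) then 1 else 0) (degree es))
    (cong₂ _+_ (trans (sum-∈? e) (h (here refl))) (sum-degree es (h ∘ there))))
    where
    step : ∀ v → degree (e ∷ es) v ≡ (if does (v ∈? e) then 1 else 0) + degree es v
    step v with does (v ∈? e)
    ... | true  = refl
    ... | false = refl
    sum-∈? : ∀ {n} (s : Subset n) → sum (λ v → if does (v ∈? s) then 1 else 0) ≡ ∣ s ∣
    sum-∈? []            = refl
    sum-∈? (inside ∷ s)  = cong suc (sum-∈? s)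
    sum-∈? (outside ∷ s) = sum-∈? s

  module _ (sparse : ∀ W → length (edges W) ≤ 2 * ∣ W ∣) where

    -- Double counting: if all degrees exceeded 2 (2 + d), there would be more incidences than the
    -- at most 2 ∣W∣ edges of size 2 + d provide.
    low-degree : ∀ W → Nonempty W → ∃ λ v → v ∈ W × degree (edges W) v ≤ 2 * (2 + d)
    low-degree W (w , w∈W) with any? (λ v → v ∈? W ×-dec degree (edges W) v ℕ.≤? 2 * (2 + d))
    ... | yes found = found
    ... | no  none  = contradiction (begin-strict
        2 * (2 + d) * ∣ W ∣                     <⟨ ℕ.*-monoˡ-< ∣ W ∣ {{∣W∣-nonZero}} (ℕ.n<1+n (2 * (2 + d))) ⟩
        suc (2 * (2 + d)) * ∣ W ∣               ≤⟨ sum-lower-bound W (degree (edges W))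
                                                     (λ v v∈W → ℕ.≰⇒> (λ h → none (v , v∈W , h))) ⟩
        sum (degree (edges W))                  ≡⟨ sum-degree (edges W) (λ e∈ → uniform _ (proj₁ (edges-sound e∈))) ⟩
        length (edges W) * (2 + d)              ≤⟨ ℕ.*-monoˡ-≤ (2 + d) (sparse W) ⟩
        2 * ∣ W ∣ * (2 + d)                     ≡⟨ solve 2 (λ w d → con 2 :* w :* d := con 2 :* d :* w) refl ∣ W ∣ (2 + d) ⟩
        2 * (2 + d) * ∣ W ∣                     ∎) (ℕ.<-irrefl refl)
      where
      open ℕ.≤-Reasoning
      open ℕ-Solver
      ∣W∣-nonZero : NonZero ∣ W ∣
      ∣W∣-nonZero = ℕ.>-nonZero (ℕ.≤-<-trans z≤n (x∈p⇒∣p-x∣<∣p∣ w∈W))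
      sum-lower-bound : ∀ {n x} (s : Subset n) g → (∀ v → v ∈ s → x ≤ g v) → x * ∣ s ∣ ≤ sum g
      sum-lower-bound {x = x} []            g h = ℕ.≤-reflexive (ℕ.*-zeroʳ x)
      sum-lower-bound {x = x} (inside ∷ s)  g h = ℕ.≤-trans (ℕ.≤-reflexive (ℕ.*-suc x ∣ s ∣))
        (ℕ.+-mono-≤ (h zero here) (sum-lower-bound s (g ∘ suc) (λ v v∈s → h (suc v) (there v∈s))))
      sum-lower-bound (outside ∷ s) g h = ℕ.≤-trans
        (sum-lower-bound s (g ∘ suc) (λ v v∈s → h (suc v) (there v∈s))) (ℕ.m≤n+m _ (g zero))

    colours : ℕ
    colours = suc (2 * (2 + d))

    fresh-colour : (cs : List (Fin colours)) → length cs < colours → ∃ λ c → c ∉ˡ cs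
    fresh-colour cs few with any? (λ c → ¬? (c ∈ˡ? cs))
      where open DecMembership _≟ꟳ_ renaming (_∈?_ to _∈ˡ?_)
    ... | yes found = found
    ... | no  none  = contradiction (ℕ.≤-<-trans
          (subst (_≤ length cs) (List.length-tabulate {n = colours} id)
            (injection⇒length≤ id (Unique.allFin⁺ colours) (λ {c} _ → all-used c) (λ _ _ eq → eq))) few)
          (ℕ.<-irrefl refl)
      where
      open DecMembership (_≟ꟳ_ {colours}) renaming (_∈?_ to _∈ˡ?_)
      all-used : ∀ c → c ∈ˡ cs
      all-used c = decidable-stable (c ∈ˡ? cs) (λ c∉ → none (c , c∉))

    -- An edge at v forbids just one colour, that of some other vertex of it. At most 2 (2 + d)
    -- edges do so, and there is one colour more.
    recolour : ∀ {W v} → v ∈ W → degree (edges W) v ≤ 2 * (2 + d) → Colourable colours (W - v) → Colourable colours W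
    recolour {W} {v} v∈W low (c , proper) = c′ , proper′
      where
      another : Subset n → Fin colours
      another e with nonempty? (e - v)
      ... | yes (w , _) = c w
      -- An arbitrary value; every edge has a vertex other than v.
      ... | no  _       = zero
      forbidden : List (Fin colours)
      forbidden = map another (filter (v ∈?_) (edges W))
      few-forbidden : length forbidden < colours
      few-forbidden = s≤s (subst (_≤ 2 * (2 + d)) (sym (List.length-map another (filter (v ∈?_) (edges W)))) low)
      x : Fin colours
      x = proj₁ (fresh-colour forbidden few-forbidden)
      x-fresh : x ∉ˡ forbidden
      x-fresh = proj₂ (fresh-colour forbidden few-forbidden)
      c′ : Fin n → Fin colours
      c′ w with w ≟ꟳ v
      ... | yes _ = x
      ... | no  _ = c w
      c′-v : c′ v ≡ x
      c′-v with v ≟ꟳ v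
      ... | yes _  = refl
      ... | no v≢v = contradiction refl v≢v
      c′-other : ∀ {w} → w ≢ v → c′ w ≡ c w
      c′-other {w} w≢v with w ≟ꟳ v
      ... | yes w≡v = contradiction w≡v w≢v
      ... | no  _   = refl
      another-monochromatic : ∀ e i → E e → (∀ w → w ∈ e → c′ w ≡ i) → another e ≡ i
      another-monochromatic e i Ee mono with nonempty? (e - v)
      ... | yes (w , w∈) = trans (sym (c′-other λ { refl → x∉s-x e v w∈ })) (mono w (p─q⊆p e ⁅ v ⁆ w∈))
      ... | no  empty    = contradiction (0<∣s∣⇒nonempty (e - v)
              (ℕ.≤-trans (s≤s z≤n) (ℕ.≤-pred (subst (_≤ suc ∣ e - v ∣) (uniform e Ee) (∣s∣≤1+∣s-x∣ e v))))) empty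
      proper′ : ∀ e → E e → e ⊆ W → ∀ i → ¬ (∀ w → w ∈ e → c′ w ≡ i)
      proper′ e Ee e⊆W i mono with v ∈? e
      ... | yes v∈e = x-fresh (subst (_∈ˡ forbidden)
              (trans (another-monochromatic e i Ee mono) (trans (sym (mono v v∈e)) c′-v))
              (∈-map⁺ another (∈-filter⁺ (v ∈?_) (∈-edges Ee e⊆W) v∈e)))
      ... | no  v∉e = proper e Ee
              (λ w∈e → x∈p∧x≢y⇒x∈p-y (e⊆W w∈e) λ { refl → v∉e w∈e }) i
              (λ w w∈e → trans (sym (c′-other λ { refl → v∉e w∈e })) (mono w w∈e))

    colourable-degenerate : ∀ N W → ∣ W ∣ ≤ N → Colourable colours W
    colourable-degenerate N W ∣W∣≤N with nonempty? W
    ... | no empty = colourable-mono (s≤s z≤n) (colourable-edgeless λ e Ee e⊆W →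
            let v , v∈e = edge-nonempty Ee in empty (v , e⊆W v∈e))
    colourable-degenerate zero    W ∣W∣≤N | yes (w , w∈W) =
      contradiction (ℕ.≤-trans (x∈p⇒∣p-x∣<∣p∣ w∈W) ∣W∣≤N) λ ()
    colourable-degenerate (suc N) W ∣W∣≤N | yes ne =
      let v , v∈W , low = low-degree W ne
      in recolour v∈W low (colourable-degenerate N (W - v)
           (ℕ.≤-pred (ℕ.≤-trans (x∈p⇒∣p-x∣<∣p∣ v∈W) ∣W∣≤N)))

  few-colours : Sparse → 1 ≤ n → ∃ λ m → Colourable m ⊤ × ∃ λ r → r ^ suc d ≤ n ^ k′ × m ≤ colourConstant d k′ * r
  few-colours sparse 1≤n = by-cases k′ refl
    where
    -- As k′ is a module parameter, the distinction is made on l and carried over by the equation.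
    by-cases : ∀ l → k′ ≡ l → ∃ λ m → Colourable m ⊤ × ∃ λ r → r ^ suc d ≤ n ^ k′ × m ≤ colourConstant d k′ * r
    by-cases zero    refl = _ , colourable-degenerate
      (λ W → ℕ.≤-trans (sparse W) (ℕ.≤-reflexive (cong (2 *_) (ℕ.*-identityʳ ∣ W ∣))))
        n ⊤ (ℕ.≤-reflexive (∣⊤∣≡n n)) ,
      -- The number of colours is bounded independently of n, and r = 1 is the root of n ^ 0.
      1 , ℕ.≤-reflexive (ℕ.^-zeroˡ (suc d)) ,
      ℕ.≤-trans (ℕ.m≤m+n _ 8) (ℕ.≤-reflexive (sym (ℕ.*-identityʳ (colourConstant d k′))))
    by-cases (suc l) refl =
      let m , col , r , r^D≤ , m≤ = colouring-bound sparse (s≤s z≤n) 1≤n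
      in m , col , r , r^D≤ , ℕ.≤-trans m≤ (ℕ.*-monoˡ-≤ r (ℕ.m≤n+m (8 * 2 ^ k′) (suc (2 * (2 + d)))))

-- Existence of the chromatic number, and the theorem

anyVec? : ∀ {m} n {P : Vec (Fin m) n → Set} → Decidable P → Dec (∃ P)
anyVec? zero    P? = map′ ([] ,_) (λ { ([] , p) → p }) (P? [])
anyVec? (suc n) P? = map′ (λ (x , v , p) → x ∷ v , p) (λ { (x ∷ v , p) → x , v , p })
  (any? λ x → anyVec? n (P? ∘ (x ∷_)))

least : ∀ {P : ℕ → Set} → Decidable P → ∀ m → P m → ∃ λ χ → P χ × ∀ l → P l → χ ≤ l
least P? m Pm with P? 0
least P? m       Pm | yes P0 = 0 , P0 , λ _ _ → z≤n
least P? zero    Pm | no ¬P0 = contradiction Pm ¬P0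
least P? (suc m) Pm | no ¬P0 =
  let χ , Pχ , minimal = least (P? ∘ suc) m Pm
  in suc χ , Pχ , λ { zero P0 → contradiction P0 ¬P0 ; (suc l) Pl → s≤s (minimal l Pl) }

-- Needed for the chromatic number to be found by search. Candidates are vectors, which can be
-- enumerated up to equality.
coloring? : ∀ {n} (H : Hypergraph n) m → Dec (Coloring H m)
coloring? {n} H m = map′ to from (anyVec? n λ c → ¬? (improper? c))
  where
  open Hypergraph H
  Improper : Vec (Fin m) n → Set
  Improper c = ∃ λ e → Edge e × ∃ λ i → ∀ v → v ∈ e → lookup c v ≡ i
  improper? : Decidable Improper
  improper? c = anySubset? λ e → edge? e ×-dec any? λ i → all? λ v → v ∈? e →-dec lookup c v ≟ꟳ i
  to : (∃ λ c → ¬ Improper c) → Coloring H m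
  to (c , proper) = lookup c , λ e Ee i mono → proper (e , Ee , i , mono)
  from : Coloring H m → ∃ λ c → ¬ Improper c
  from (c , proper) = tabulate c , λ (e , Ee , i , mono) →
    proper e Ee i λ v v∈e → trans (sym (lookup∘tabulate c v)) (mono v v∈e)

real-ordered-ring : OrderedRing
real-ordered-ring = record
  { commutativeSemiring = Real.commutativeSemiring
  ; -1#         = Real.-1ℝ
  ; 1-1≈0       = Real.≗⇒≃ {1ℝ +ℝ Real.-1ℝ} {0ℝ} λ _ → refl
  ; NonNeg      = 0ℝ ≤ℝ_
  ; NonNeg-resp = λ {x} {y} (x≤y , _) 0≤x → Real.≤ℝ-trans {0ℝ} {x} {y} 0≤x x≤y
  ; NonNeg-0    = proj₁ (Real.≗⇒≃ {0ℝ} {0ℝ} λ _ → refl)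
  ; NonNeg-+    = λ {x} {y} → Real.+-nonNegative {x} {y}
  ; NonNeg-*    = λ {x} {y} → Real.*-nonNegative {x} {y}
  ; sign        = λ x undecided → undecided (inj₂ (Real.negative⇒-nonNegative x (undecided ∘ inj₁)))
  ; 1≉0         = Real.1≄0
  ; *-nonZero   = λ {x} {y} → Real.*-nonZero x y
  ; ι           = fromℕ
  ; ι-zero      = Real.≗⇒≃ {fromℕ 0} {0ℝ} λ _ → refl
  ; ι-suc       = λ k → Real.≗⇒≃ {fromℕ (suc k)} {1ℝ +ℝ fromℕ k} λ _ → Real.fromℕ-suc k
  ; reciprocal  = Real.reciprocal
  ; archimedean = Real.archimedean
  }

-- With homogeneous coordinates (1 , p v), the coordinates of `P` after the first compute
-- `plExtension`, so injectivity of the embedding is what the geometric part asks for.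
embedding⇒charging : ∀ {n d} (H : Hypergraph n) → Uniform H (2 + d) → LinearlyEmbeddable (suc d) H →
  ¬ ¬ Charging (Hypergraph.Edge H) (suc ⌊ d /2⌋)
embedding⇒charging {n} {d} H uniform (p , embedding) =
  Geometry.charging real-ordered-ring P (λ v → refl-≃ {1ℝ}) Edge injective uniform (s≤s z≤n) (s≤s z≤n) d≤2k
  where
  open Hypergraph H
  open OrderedRing real-ordered-ring using ()
    renaming (refl to refl-≃; trans to ≃-trans; sym to ≃-sym; *-identityʳ to *ℝ-identityʳ)
  open LinearAlgebra real-ordered-ring using (⟨_,_⟩; sum-cong-≋)
  P : Fin (2 + d) → Fin n → ℝ
  P zero    v = 1ℝ
  P (suc i) v = p v i
  realization : ∀ α → Geometry.Point real-ordered-ring P (λ v → refl-≃ {1ℝ}) Edge α → Realization H α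
  realization α (0≤α , Σα≃1 , e , Ee , α⊆e) = record
    { nonNegative = 0≤α
    ; total       = ≃-trans {∑ α} {⟨ α , P zero ⟩} {1ℝ}
                      (sum-cong-≋ {n} {α} {λ v → α v *ℝ 1ℝ} λ v → ≃-sym {α v *ℝ 1ℝ} {α v} (*ℝ-identityʳ (α v))) Σα≃1
    ; support     = e , (e , Ee , id) , α⊆e
    }
  injective : ∀ α β → _ → _ → (∀ j → ⟨ α , P j ⟩ ≃ ⟨ β , P j ⟩) → ∀ v → α v ≃ β v
  injective α β α-point β-point Pα≃Pβ =
    IsEmbedding.injective embedding (realization α α-point) (realization β β-point) (Pα≃Pβ ∘ suc)
  -- In dimension d + 1 the number k = ⌈ (d + 1) / 2 ⌉ is ⌊ d / 2 ⌋ + 1.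
  d≤2k : suc d ≤ suc ⌊ d /2⌋ + suc ⌊ d /2⌋
  d≤2k = s≤s (begin
    d                            ≡⟨ ℕ.⌊n/2⌋+⌈n/2⌉≡n d ⟨
    ⌊ d /2⌋ + ⌈ d /2⌉            ≤⟨ ℕ.+-monoʳ-≤ ⌊ d /2⌋ (ℕ.⌊n/2⌋-mono (ℕ.n≤1+n (suc d))) ⟩
    ⌊ d /2⌋ + suc ⌊ d /2⌋        ∎)
    where open ℕ.≤-Reasoning

theorem6p1 : (d : ℕ) .{{_ : NonZero d}} →
    ∃ λ (C : ℝ) →
    (n : ℕ) .{{_ : NonZero n}} (H : Hypergraph n) →
    Uniform H (suc d) →
    LinearlyEmbeddable d H →
    ∃ λ (χ : ℕ) → IsChromaticNumber H χ ×
    (fromℕ χ ≤ℝ C *ℝ (n ^[ (⌈ d /2⌉ ∸ 1) / d ]))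
theorem6p1 (suc d) = fromℕ K , bound
  where
  -- The exponent `⌈ suc d /2⌉ ∸ 1` of the statement reduces to this by computation.
  k′ = ⌊ d /2⌋
  K = colourConstant d k′
  bound : (n : ℕ) .{{_ : NonZero n}} (H : Hypergraph n) → Uniform H (2 + d) → LinearlyEmbeddable (suc d) H →
    ∃ λ (χ : ℕ) → IsChromaticNumber H χ × (fromℕ χ ≤ℝ fromℕ K *ℝ (n ^[ k′ / suc d ]))
  bound n H uniform embeddable =
    let open Hypergraph H
        module C = Colouring Edge edge? d k′ uniform
        sparse = C.sparse-stable (λ ¬sparse → embedding⇒charging H uniform embeddable (¬sparse ∘ C.charging⇒sparse))
        m , (c , proper) , r , r^d≤ , m≤K*r = C.few-colours sparse (ℕ.>-nonZero⁻¹ n)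
        H-coloring : Coloring H m
        H-coloring = c , λ e Ee → proper e Ee ⊆⊤
        χ , χ-coloring , minimal = least (coloring? H) m H-coloring
    in χ , (χ-coloring , minimal) , 
       Real.fromℕ-≤-root (suc d) (n ^ k′) K χ r r^d≤ (ℕ.≤-trans (minimal m H-coloring) m≤K*r)
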